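{- The extremal problem of every PromiseBPP-machine and of every PromiseMA-machine is totally decidable.
   Context: Let $\Sigma=\{0,1\}$. A promise problem is a pair $A=(A_{\text{yes}},A_{\text{no}})$ of disjoint subsets of $\Sigma^*$. It is totally decidable iff there is a deterministic Turing machine (DTM) $M$ with $M(x)=1$ for all $x\in A_{\text{yes}}$, $M(x)=0$ for all $x\in A_{\text{no}}$, and $M(x)=10$ for all $x\in\Sigma^*\setminus(A_{\text{yes}}\cup A_{\text{no}})$. A function $f:\mathbb{N}_0\to\mathbb{N}_0$ is in $\mathrm{poly}$ iff it is polynomially bounded and some DTM outputs the binary representation of $f(n)$ on all inputs of length $n$ in polynomial time. A probabilistic Turing machine (PTM) is a Turing machine whose transition function maps to sets of possible transitions; its acceptance probability $P_{\text{acc}}$ on an input is the number of accepting branches (halting with output 1) divided by the number of all branches. It has polynomial runtime if for some polynomial $p$ every branch halts within $p(n)$ steps on every input of length $n$ (promised or not). - PromiseBPP-machine $M$: a PTM of polynomial runtime; put $v_M(x)=P_{\text{acc}}(x)$. - PromiseMA-machine $M$: a PTM of polynomial runtime together with an $m\in\mathrm{poly}$; put $v_M(x)=\max_{y\in\Sigma^{m(|x|)}}P_{\text{acc}}(x,y)$. $M$ decides $A$ iff $v_M(x)\ge\frac23$ for all $x\in A_{\text{yes}}$ and $v_M(x)\le\frac13$ for all $x\in A_{\text{no}}$. The extremal problem $P(M)$ is the promise problem with the largest promise decided by $M$: $P(M)_{\text{yes}}=\{x: v_M(x)\ge\frac23\}$, $P(M)_{\text{no}}=\{x: v_M(x)\le\frac13\}$.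 -}

module Defs where

open import Data.Digit using (Bit; 0b; 1b; toDigits)
open import Data.Fin.Base using (Fin)
import Data.Fin.Properties as Fin
open import Data.Integer.Base using (+_)
open import Data.List.Base as List using (List; []; _∷_; _++_; filter; reverse)
open import Data.List.Membership.Propositional using (_∈_)
open import Data.List.NonEmpty.Base as List⁺ using (List⁺; _∷_)
open import Data.List.Properties using (≡-dec)
open import Data.List.Relation.Unary.All using (All)
open import Data.List.Relation.Unary.Unique.Propositional using (Unique)
open import Data.Nat.Base as ℕ using (ℕ; zero; suc)
open import Data.Product.Base using (Σ; ∃; _×_; _,_; proj₁; proj₂)
open import Data.Rational.Base using (ℚ; _/_; _≤_; _≥_; _⊔_)
open import Data.Rational.Properties using (≤-trans; _≤?_)
open import Data.Vec.Base as Vec using (Vec; []; _∷_)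
open import Function.Bundles using (_↔_)
open import Level using (0ℓ)
open import Relation.Binary.Construct.Closure.ReflexiveTransitive using (Star)
open import Relation.Binary.PropositionalEquality using (_≡_)
open import Relation.Nullary.Decidable using (Dec; from-no)
open import Relation.Unary using (Pred; _∉_; _⊥_)

Word : Set
Word = List Bit

record PromiseProblem : Set₁ where
  field
    yes      : Pred Word 0ℓ
    no       : Pred Word 0ℓ
    disjoint : yes ⊥ no

-- Polynomials with natural coefficients, constant term first.
Polynomial : Set
Polynomial = List ℕ

eval : Polynomial → ℕ → ℕ
eval []      n = 0
eval (a ∷ p) n = a ℕ.+ n ℕ.* eval p n

-- Most significant digit first; 0 is represented by the word 0.
binary : ℕ → Word
binary n = reverse (proj₁ (toDigits 2 n))

------------------------------------------------------------------------
-- Tapes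

Finite : Set → Set
Finite A = ∃ λ n → A ↔ Fin n

data Symbol (W : Set) : Set where
  blank : Symbol W
  bit   : Bit → Symbol W
  work  : W → Symbol W

data Move : Set where
  left stay right : Move

-- A two-way infinite tape.  `before` lists the cells to the left of the
-- head, nearest first, `after` those to its right; all cells not listed
-- are blank.
record Tape (W : Set) : Set where
  constructor tape
  field
    before  : List (Symbol W)
    current : Symbol W
    after   : List (Symbol W)

open Tape public

module _ {W : Set} where

  move : Move → Tape W → Tape W
  move left  (tape []       a rs)       = tape [] blank (a ∷ rs)
  move left  (tape (l ∷ ls) a rs)       = tape ls l (a ∷ rs)
  move stay  t                          = t
  move right (tape ls       a [])       = tape (a ∷ ls) blank []
  move right (tape ls       a (r ∷ rs)) = tape (a ∷ ls) r rs

  write : Symbol W → Tape W → Tape W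
  write a t = record t { current = a }

  act : Symbol W × Move → Tape W → Tape W
  act (a , m) t = move m (write a t)

  blankTape : Tape W
  blankTape = tape [] blank []

  -- The head is on the first letter.
  wordTape : Word → Tape W
  wordTape []      = blankTape
  wordTape (b ∷ w) = tape [] (bit b) (List.map bit w)

  bitPrefix : List (Symbol W) → Word
  bitPrefix (bit b ∷ as) = b ∷ bitPrefix as
  bitPrefix _            = []

  -- The word that starts at the head and extends up to the first cell
  -- not containing a bit.
  readWord : Tape W → Word
  readWord t = bitPrefix (current t ∷ after t)

------------------------------------------------------------------------
-- Turing machines

record Configuration (Q W : Set) (k : ℕ) : Set where
  constructor config
  field
    state : Q
    tapes : Vec (Tape W) k

open Configuration public

-- A multi-tape machine; δ gives the set of possible transitions, as a list
-- without repetitions.  The machine halts when this set is empty.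
record TM : Set₁ where
  field
    State        : Set
    Work         : Set
    finiteState  : Finite State
    finiteWork   : Finite Work
    workTapes    : ℕ
    start        : State

  Transition : Set
  Transition = State × Vec (Symbol Work × Move) (suc workTapes)

  field
    δ        : State → Vec (Symbol Work) (suc workTapes) → List Transition
    δ-unique : ∀ q as → Unique (δ q as)

  Config : Set
  Config = Configuration State Work (suc workTapes)

  apply : Vec (Tape Work) (suc workTapes) → Transition → Config
  apply ts (q , acts) = config q (Vec.zipWith act acts ts)

  -- Indexed by the possible transitions: configurations are not identified
  -- when they are reached by different ones.
  successors : Config → List Config
  successors (config q ts) = List.map (apply ts) (δ q (Vec.map current ts))

  infix 4 _⊢_

  _⊢_ : Config → Config → Set
  c ⊢ d = d ∈ successors c

  Halted : Config → Set
  Halted c = successors c ≡ []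

  -- The first tape serves as both input and output tape.
  initial : Word → Config
  initial x = config start (wordTape x ∷ Vec.replicate workTapes blankTape)

  output : Config → Word
  output c = readWord (Vec.head (tapes c))

  -- Every branch starting in the configuration halts after at most t steps.
  HaltsWithin : ℕ → Config → Set
  HaltsWithin zero    c = Halted c
  HaltsWithin (suc t) c = All (HaltsWithin t) (successors c)

  -- The final configurations of the branches starting in a configuration,
  -- one for each branch, where branches are cut off after t steps.  With
  -- HaltsWithin t c nothing is cut off, and the result is independent of t.
  mutual
    branches : ℕ → Config → List⁺ Config
    branches zero    c = c ∷ []
    branches (suc t) c = branchesVia t c (successors c)

    branchesVia : ℕ → Config → List Config → List⁺ Config
    branchesVia t c []       = c ∷ []
    branchesVia t c (d ∷ ds) = List⁺.concatMap (branches t) (d ∷ ds)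

  Accepting : Config → Set
  Accepting c = output c ≡ 1b ∷ []

  accepting? : ∀ c → Dec (Accepting c)
  accepting? c = ≡-dec Fin._≟_ (output c) (1b ∷ [])

PolynomialRuntime : TM → Set
PolynomialRuntime M =
  Σ Polynomial λ p → ∀ x → HaltsWithin (eval p (List.length x)) (initial x)
  where open TM M

record DTM : Set₁ where
  field
    machine       : TM
    deterministic : ∀ q as → List.length (TM.δ machine q as) ℕ.≤ 1

Outputs : DTM → Word → Word → Set
Outputs D x w = ∃ λ c → Star _⊢_ (initial x) c × Halted c × output c ≡ w
  where open TM (DTM.machine D)

TotallyDecidable : PromiseProblem → Set₁
TotallyDecidable A = Σ DTM λ D →
    (∀ x → yes x → Outputs D x (1b ∷ []))
  × (∀ x → no x → Outputs D x (0b ∷ []))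
  × (∀ x → x ∉ yes → x ∉ no → Outputs D x (1b ∷ 0b ∷ []))
  where open PromiseProblem A

record Poly (f : ℕ → ℕ) : Set₁ where
  field
    bound    : Polynomial
    bounded  : ∀ n → f n ℕ.≤ eval bound n
    computer : DTM
    runtime  : PolynomialRuntime (DTM.machine computer)
    computes : ∀ x → Outputs computer x (binary (f (List.length x)))

------------------------------------------------------------------------
-- Probabilistic polynomial-time machines

record PolytimePTM : Set₁ where
  field
    machine : TM
    runtime : PolynomialRuntime machine

  open TM machine

  allBranches : Word → List⁺ Config
  allBranches x = branches (eval (proj₁ runtime) (List.length x)) (initial x)

  acceptingBranches : Word → List Config
  acceptingBranches x = filter accepting? (List⁺.toList (allBranches x))

  Pacc : Word → ℚ
  Pacc x = + List.length (acceptingBranches x) / List⁺.length (allBranches x)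

-- A self-delimiting encoding of pairs: each letter of x is preceded by 1,
-- and a 0 announces y.
⟨_,_⟩ : Word → Word → Word
⟨ []    , y ⟩ = 0b ∷ y
⟨ b ∷ x , y ⟩ = 1b ∷ b ∷ ⟨ x , y ⟩

maxOver : ∀ n → (Vec Bit n → ℚ) → ℚ
maxOver zero    f = f []
maxOver (suc n) f = maxOver n (λ y → f (0b ∷ y)) ⊔ maxOver n (λ y → f (1b ∷ y))

record PromiseBPPMachine : Set₁ where
  field
    ptm : PolytimePTM

  v : Word → ℚ
  v = PolytimePTM.Pacc ptm

record PromiseMAMachine : Set₁ where
  field
    ptm    : PolytimePTM
    m      : ℕ → ℕ
    m∈poly : Poly m

  v : Word → ℚ
  v x = maxOver (m (List.length x))
          (λ y → PolytimePTM.Pacc ptm ⟨ x , Vec.toList y ⟩)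

extremal : (Word → ℚ) → PromiseProblem
extremal v = record
  { yes      = λ x → v x ≥ + 2 / 3
  ; no       = λ x → v x ≤ + 1 / 3
  ; disjoint = λ (v≥⅔ , v≤⅓) →
      from-no (+ 2 / 3 ≤? + 1 / 3) (≤-trans v≥⅔ v≤⅓)
  }

P-BPP : PromiseBPPMachine → PromiseProblem
P-BPP M = extremal (PromiseBPPMachine.v M)

P-MA : PromiseMAMachine → PromiseProblem
P-MA M = extremal (PromiseMAMachine.v M)

{-# OPTIONS --safe #-}
module Submission where

-- A deterministic machine can traverse the whole computation tree of a
-- polynomial-time machine depth first: a stack records, for each transition on
-- the current path, the symbols it overwrote, so that transitions can be undone.
-- Two counters maintain a - 2r and 2a - r, where a and r are the numbers of
-- accepting and rejecting leaves, and their signs decide whether the acceptance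
-- probability is at least 2/3 and at most 1/3.  For an MA machine the traversed
-- machine first computes the length of the proof y and guesses y; the counters
-- are then evaluated and reset for each y, i.e. at each root of a tree of the
-- verifier inside the whole tree.

open import Defs
open import Data.Bool.Base using (Bool; true; false; not; _∨_; _∧_)
import Data.Bool.Properties as Bool
open import Data.Digit using (Bit; 0b; 1b; fromDigits; toDigits)
open import Data.Empty using (⊥)
open import Data.Fin.Base using (Fin; zero; suc)
import Data.Fin.Properties as Fin
open import Data.Integer.Base as ℤ using (ℤ; +_; -[1+_]; ∣_∣; _⊖_)
import Data.Integer.Properties as ℤ
open import Data.List.Base as List using (List; []; _∷_; _ʳ++_; filter)
open import Data.List.Membership.Propositional using (_∈_)
import Data.List.NonEmpty.Base as List⁺
import Data.List.Properties as List
open import Data.List.Relation.Unary.All using (All; []; _∷_)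
open import Data.List.Relation.Unary.AllPairs using ([]; _∷_)
open import Data.List.Relation.Unary.Any using (here)
open import Data.List.Relation.Unary.Unique.Propositional using (Unique)
open import Data.Maybe.Base as Maybe using (Maybe; just; nothing; maybe; _>>=_)
open import Data.Nat.Base as ℕ using (ℕ; zero; suc; z≤n; s≤s)
import Data.Nat.Properties as ℕ
open import Data.Nat.Tactic.RingSolver using (solve-∀)
open import Data.Product.Base using (Σ; ∃; _×_; _,_; proj₁; proj₂)
open import Data.Product.Function.Dependent.Propositional using (Σ-↔)
open import Data.Product.Function.NonDependent.Propositional using (_×-↔_)
open import Data.Rational.Base using (ℚ; _/_; _≤_; _⊔_)
import Data.Rational.Properties as ℚ
open import Data.Rational.Unnormalised.Base using (mkℚᵘ; *≤*)
import Data.Rational.Unnormalised.Properties as ℚᵘ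
open import Data.Sum using (isInj₁; isInj₂)
open import Data.Sum.Base using (_⊎_; inj₁; inj₂; [_,_]′)
open import Data.Sum.Function.Propositional using (_⊎-↔_)
open import Data.Unit.Base using (⊤; tt)
open import Data.Vec.Base as Vec using (Vec; []; _∷_; _++_)
import Data.Vec.Properties as Vec
open import Function.Base using (_∘_; id)
open import Function.Bundles using (_↔_; mk↔ₛ′; Inverse; _⇔_; mk⇔)
open import Function.Construct.Composition using (_↔-∘_; _⇔-∘_)
open import Function.Construct.Identity using (↔-id)
open import Function.Construct.Symmetry using (↔-sym)
open import Relation.Binary.Construct.Closure.ReflexiveTransitive using (Star; ε; _◅_; _◅◅_)
open import Relation.Binary.PropositionalEquality
  using (_≡_; refl; sym; trans; cong; cong₂; subst; subst₂; module ≡-Reasoning)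
open import Relation.Nullary.Decidable
  using (does; dec-true; dec-false; does-⇔; _⊎-dec_; _×-dec_)
open import Relation.Nullary.Negation using (¬_; contradiction)

-- The probability is `a / (a + r)`, so clearing denominators turns the thresholds 2/3 and 1/3 into
-- `2r ≤ a` and `2a ≤ r`, comparisons of integers with zero that need only counting. A maximum is at
-- least 2/3 iff some value is, and at most 1/3 iff all are, so two bits carry the results from one
-- proof to the next. The traversing machine does not compute the runtime polynomial. The bound
-- serves to build a finite derivation of `Explored`, and the search is proved correct by recursion
-- on that derivation. `Explored` also separates the concerns: the search works for any
-- nondeterministic machine, and the guessing machine only has to have the right tree. Backtracking
-- does not restore a tape literally, since a head that has passed the listed cells leaves an
-- explicit blank behind. Hence the traversed tapes are controlled only up to trailing blanks.

-- Finite types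

abstract

  finite-↔ : {A B : Set} → A ↔ B → Finite B → Finite A
  finite-↔ f (n , g) = n , g ↔-∘ f

  finite-⊎ : {A B : Set} → Finite A → Finite B → Finite (A ⊎ B)
  finite-⊎ (m , f) (n , g) = m ℕ.+ n , ↔-sym Fin.+↔⊎ ↔-∘ (f ⊎-↔ g)

  finite-× : {A B : Set} → Finite A → Finite B → Finite (A × B)
  finite-× (m , f) (n , g) = m ℕ.* n , ↔-sym Fin.*↔× ↔-∘ (f ×-↔ g)

  finite-Fin : ∀ {n} → Finite (Fin n)
  finite-Fin {n} = n , ↔-id _

  finite-⊤ : Finite ⊤
  finite-⊤ = 1 , ↔-sym Fin.1↔⊤

  finite-⊥ : Finite ⊥
  finite-⊥ = 0 , ↔-sym Fin.0↔⊥

  finite-Bool : Finite Bool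
  finite-Bool = 2 , ↔-sym Fin.2↔Bool

  finite-Vec : ∀ {A} n → Finite A → Finite (Vec A n)
  finite-Vec zero    F = finite-↔
    (mk↔ₛ′ (λ _ → tt) (λ _ → []) (λ _ → refl) (λ { [] → refl })) finite-⊤
  finite-Vec (suc n) F = finite-↔
    (mk↔ₛ′ Vec.uncons (λ p → proj₁ p ∷ proj₂ p) (λ _ → refl)
       (λ { (_ ∷ _) → refl }))
    (finite-× F (finite-Vec n F))

  finite-Symbol : ∀ {W} → Finite W → Finite (Symbol W)
  finite-Symbol F = finite-↔
    (mk↔ₛ′ (λ { blank → inj₁ tt ; (bit b) → inj₂ (inj₁ b) ; (work w) → inj₂ (inj₂ w) })
       (λ { (inj₁ _) → blank ; (inj₂ (inj₁ b)) → bit b ; (inj₂ (inj₂ w)) → work w })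
       (λ { (inj₁ _) → refl ; (inj₂ (inj₁ _)) → refl ; (inj₂ (inj₂ _)) → refl })
       (λ { blank → refl ; (bit _) → refl ; (work _) → refl }))
    (finite-⊎ finite-⊤ (finite-⊎ finite-Fin F))

  finite-ΣFin : ∀ n (f : Fin n → ℕ) → Finite (Σ (Fin n) (Fin ∘ f))
  finite-ΣFin zero    f = finite-↔ (mk↔ₛ′ (λ ()) (λ ()) (λ ()) (λ ())) finite-⊥
  finite-ΣFin (suc n) f = finite-↔
    (mk↔ₛ′ (λ { (zero , j) → inj₁ j ; (suc i , j) → inj₂ (i , j) })
       (λ { (inj₁ j) → zero , j ; (inj₂ (i , j)) → suc i , j })
       (λ { (inj₁ _) → refl ; (inj₂ _) → refl })
       (λ { (zero , _) → refl ; (suc _ , _) → refl }))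
    (finite-⊎ finite-Fin (finite-ΣFin n (f ∘ suc)))

  -- Needed for stack frames, in which the range of the transition index depends on the state and
  -- the symbols read.
  finite-Σ : {A : Set} → Finite A → (f : A → ℕ) → Finite (Σ A (Fin ∘ f))
  finite-Σ {A} (n , g) f = finite-↔
    (↔-sym (Σ-↔ (↔-sym g) (↔-id _)))
    (finite-ΣFin n (f ∘ Inverse.from g))

-- Tapes up to trailing blanks

-- `nothing` keeps the scanned symbol, so that a head can rest or move without the action depending
-- on what it reads.
Action : Set → Set
Action W = Maybe (Symbol W) × Move

perform : ∀ {W} → Action W → Tape W → Tape W
perform (nothing , m) t = move m t
perform (just a  , m) t = act (a , m) t

inverse : Move → Move
inverse left  = right
inverse stay  = stay
inverse right = left

module _ {W : Set} where

  cell : List (Symbol W) → ℕ → Symbol W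
  cell []       _       = blank
  cell (a ∷ _)  zero    = a
  cell (_ ∷ as) (suc n) = cell as n

  uncons : List (Symbol W) → Symbol W × List (Symbol W)
  uncons []       = blank , []
  uncons (a ∷ as) = a , as

  infix 4 _≋_ _≈_

  -- Lists are compared as half-infinite sequences of cells, since moving off the listed cells and
  -- back adds an explicit blank.
  _≋_ : List (Symbol W) → List (Symbol W) → Set
  as ≋ bs = ∀ n → cell as n ≡ cell bs n

  record _≈_ (t u : Tape W) : Set where
    constructor ⟪_,_,_⟫
    field
      before-≋  : before t ≋ before u
      current-≡ : current t ≡ current u
      after-≋   : after t ≋ after u

  open _≈_ public

  ≈-refl : ∀ {t} → t ≈ t
  ≈-refl = ⟪ (λ _ → refl) , refl , (λ _ → refl) ⟫

  ≈-sym : ∀ {t u} → t ≈ u → u ≈ t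
  ≈-sym ⟪ p , q , r ⟫ = ⟪ sym ∘ p , sym q , sym ∘ r ⟫

  ≈-trans : ∀ {t u v} → t ≈ u → u ≈ v → t ≈ v
  ≈-trans ⟪ p , q , r ⟫ ⟪ p′ , q′ , r′ ⟫ =
    ⟪ (λ n → trans (p n) (p′ n)) , trans q q′ , (λ n → trans (r n) (r′ n)) ⟫

  move-left : ∀ t → move left t ≡
    tape (proj₂ (uncons (before t))) (proj₁ (uncons (before t))) (current t ∷ after t)
  move-left (tape []      a rs) = refl
  move-left (tape (_ ∷ _) a rs) = refl

  move-right : ∀ t → move right t ≡
    tape (current t ∷ before t) (proj₁ (uncons (after t))) (proj₂ (uncons (after t)))
  move-right (tape ls a [])      = refl
  move-right (tape ls a (_ ∷ _)) = refl

  ∷-≋ : ∀ {a b as bs} → a ≡ b → as ≋ bs → a ∷ as ≋ b ∷ bs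
  ∷-≋ p q zero    = p
  ∷-≋ p q (suc n) = q n

  head-≋ : ∀ as bs → as ≋ bs → proj₁ (uncons as) ≡ proj₁ (uncons bs)
  head-≋ as bs p = trans (sym (cell-zero as)) (trans (p 0) (cell-zero bs))
    where
    cell-zero : ∀ cs → cell cs 0 ≡ proj₁ (uncons cs)
    cell-zero []      = refl
    cell-zero (_ ∷ _) = refl

  tail-≋ : ∀ as bs → as ≋ bs → proj₂ (uncons as) ≋ proj₂ (uncons bs)
  tail-≋ as bs p n = trans (sym (cell-suc as)) (trans (p (suc n)) (cell-suc bs))
    where
    cell-suc : ∀ cs → cell cs (suc n) ≡ cell (proj₂ (uncons cs)) n
    cell-suc []      = refl
    cell-suc (_ ∷ _) = refl

  uncons-≋ : ∀ as → proj₁ (uncons as) ∷ proj₂ (uncons as) ≋ as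
  uncons-≋ []       zero    = refl
  uncons-≋ []       (suc n) = refl
  uncons-≋ (_ ∷ as) n       = refl

  move-cong : ∀ m {t u} → t ≈ u → move m t ≈ move m u
  move-cong left {t} {u} ⟪ p , q , r ⟫ rewrite move-left t | move-left u =
    ⟪ tail-≋ (before t) (before u) p , head-≋ (before t) (before u) p , ∷-≋ q r ⟫
  move-cong stay p = p
  move-cong right {t} {u} ⟪ p , q , r ⟫ rewrite move-right t | move-right u =
    ⟪ ∷-≋ q p , head-≋ (after t) (after u) r , tail-≋ (after t) (after u) r ⟫

  perform-cong : ∀ a {t u} → t ≈ u → perform a t ≈ perform a u
  perform-cong (nothing , m) p             = move-cong m p
  perform-cong (just a  , m) ⟪ p , q , r ⟫ = move-cong m ⟪ p , refl , r ⟫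

  move-inverse : ∀ m t → move (inverse m) (move m t) ≈ t
  move-inverse left  t rewrite move-left t = ⟪ uncons-≋ (before t) , refl , (λ _ → refl) ⟫
  move-inverse stay  t = ≈-refl
  move-inverse right t rewrite move-right t = ⟪ (λ _ → refl) , refl , uncons-≋ (after t) ⟫

  -- Reversing the move brings the head back to the one cell that may have changed; writing the old
  -- symbol there cancels the write, whatever it was.
  perform-undo : ∀ w m t →
    write (current t) (move (inverse m) (perform (w , m) t)) ≈ t
  perform-undo nothing m t with move-inverse m t
  ... | ⟪ p , q , r ⟫ = ⟪ p , refl , r ⟫
  perform-undo (just a) m t with move-inverse m (write a t)
  ... | ⟪ p , q , r ⟫ = ⟪ p , refl , r ⟫

-- Heterogeneous families of tapes

infixr 4 _⊗_

data Shape : Set₁ where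
  one : {W : Set} → Finite W → Shape
  vec : {W : Set} → Finite W → ℕ → Shape
  _⊗_ : Shape → Shape → Shape

Tapes : Shape → Set
Tapes (one {W} _)   = Tape W
Tapes (vec {W} _ n) = Vec (Tape W) n
Tapes (s ⊗ t)       = Tapes s × Tapes t

Symbols : Shape → Set
Symbols (one {W} _)   = Symbol W
Symbols (vec {W} _ n) = Vec (Symbol W) n
Symbols (s ⊗ t)       = Symbols s × Symbols t

-- A whole block of tapes can be skipped by `nothing`, so that skipping it reduces definitionally
-- even when `n` is a variable.
Actions : Shape → Set
Actions (one {W} _)   = Action W
Actions (vec {W} _ n) = Maybe (Vec (Action W) n)
Actions (s ⊗ t)       = Actions s × Actions t

symbols : ∀ s → Tapes s → Symbols s
symbols (one _)   t       = current t
symbols (vec _ n) ts      = Vec.map current ts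
symbols (s ⊗ t)   (u , v) = symbols s u , symbols t v

performs : ∀ s → Actions s → Tapes s → Tapes s
performs (one _)   a         t       = perform a t
performs (vec _ n) nothing   ts      = ts
performs (vec _ n) (just as) ts      = Vec.zipWith perform as ts
performs (s ⊗ t)   (a , b)   (u , v) = performs s a u , performs t b v

skip : ∀ s → Actions s
skip (one _)   = nothing , stay
skip (vec _ _) = nothing
skip (s ⊗ t)   = skip s , skip t

blanks : ∀ s → Tapes s
blanks (one _)   = blankTape
blanks (vec _ n) = Vec.replicate n blankTape
blanks (s ⊗ t)   = blanks s , blanks t

abstract

  finite-Symbols : ∀ s → Finite (Symbols s)
  finite-Symbols (one F)   = finite-Symbol F
  finite-Symbols (vec F n) = finite-Vec n (finite-Symbol F)
  finite-Symbols (s ⊗ t)   = finite-× (finite-Symbols s) (finite-Symbols t)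

performs-skip : ∀ s u → performs s (skip s) u ≡ u
performs-skip (one _)   t       = refl
performs-skip (vec _ n) ts      = refl
performs-skip (s ⊗ t)   (u , v) = cong₂ _,_ (performs-skip s u) (performs-skip t v)

moveBack : ∀ s → Actions s → Actions s
moveBack (one _)   (_ , m)   = nothing , inverse m
moveBack (vec _ n) as        = Maybe.map (Vec.map (λ (_ , m) → nothing , inverse m)) as
moveBack (s ⊗ t)   (a , b)   = moveBack s a , moveBack t b

overwrite : ∀ s → Symbols s → Actions s
overwrite (one _)   a       = just a , stay
overwrite (vec _ n) as      = just (Vec.map (λ a → just a , stay) as)
overwrite (s ⊗ t)   (a , b) = overwrite s a , overwrite t b

data _≈ᵛ_ {W : Set} : ∀ {n} → Vec (Tape W) n → Vec (Tape W) n → Set where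
  []  : [] ≈ᵛ []
  _∷_ : ∀ {n t u} {ts us : Vec (Tape W) n} → t ≈ u → ts ≈ᵛ us → (t ∷ ts) ≈ᵛ (u ∷ us)

Similar : ∀ s → Tapes s → Tapes s → Set
Similar (one _)   t       u         = t ≈ u
Similar (vec _ n) ts      us        = ts ≈ᵛ us
Similar (s ⊗ t)   (u , v) (u′ , v′) = Similar s u u′ × Similar t v v′

similar-refl : ∀ s {u} → Similar s u u
similar-refl (one _)            = ≈-refl
similar-refl (vec _ _) {[]}     = []
similar-refl (vec F _) {_ ∷ _}  = ≈-refl ∷ similar-refl (vec F _)
similar-refl (s ⊗ t)            = similar-refl s , similar-refl t

similar-trans : ∀ s {u v w} → Similar s u v → Similar s v w → Similar s u w
similar-trans (one _)   p        q         = ≈-trans p q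
similar-trans (vec _ _) []       []        = []
similar-trans (vec F _) (p ∷ ps) (q ∷ qs)  = ≈-trans p q ∷ similar-trans (vec F _) ps qs
similar-trans (s ⊗ t)   (p , q)  (p′ , q′) = similar-trans s p p′ , similar-trans t q q′

symbols-cong : ∀ s {u v} → Similar s u v → symbols s u ≡ symbols s v
symbols-cong (one _)   p        = current-≡ p
symbols-cong (vec _ _) []       = refl
symbols-cong (vec F _) (p ∷ ps) = cong₂ _∷_ (current-≡ p) (symbols-cong (vec F _) ps)
symbols-cong (s ⊗ t)   (p , q)  = cong₂ _,_ (symbols-cong s p) (symbols-cong t q)

performs-cong : ∀ s a {u v} → Similar s u v → Similar s (performs s a u) (performs s a v)
performs-cong (one _)   a               p        = perform-cong a p
performs-cong (vec _ _) nothing         p        = p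
performs-cong (vec _ _) (just [])       []       = []
performs-cong (vec F _) (just (a ∷ as)) (p ∷ ps) =
  perform-cong a p ∷ performs-cong (vec F _) (just as) ps
performs-cong (s ⊗ t)   (a , b)         (p , q)  = performs-cong s a p , performs-cong t b q

performs-undo : ∀ s a u → Similar s
  (performs s (overwrite s (symbols s u)) (performs s (moveBack s a) (performs s a u))) u
performs-undo (one _)   (w , m)   t             = perform-undo w m t
performs-undo (vec F _) nothing   []       = []
performs-undo (vec F _) nothing   (t ∷ ts) = ≈-refl ∷ performs-undo (vec F _) nothing ts
performs-undo (vec F _) (just []) []                         = []
performs-undo (vec F _) (just ((w , m) ∷ as)) (t ∷ ts) =
  perform-undo w m t ∷ performs-undo (vec F _) (just as) ts
performs-undo (s ⊗ t)   (a , b)   (u , v) = performs-undo s a u , performs-undo t b v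

-- Compilation of deterministic machines

record Machine (s : Shape) : Set₁ where
  field
    State       : Set
    finiteState : Finite State
    start       : State
    δ           : State → Symbols s → Maybe (State × Actions s)

  data _⟶_ : State × Tapes s → State × Tapes s → Set where
    step : ∀ {q ts q′ a} → δ q (symbols s ts) ≡ just (q′ , a) →
           (q , ts) ⟶ (q′ , performs s a ts)

size : Shape → ℕ
size (one _)   = 1
size (vec _ n) = n
size (s ⊗ t)   = size s ℕ.+ size t

Alphabet : Shape → Set
Alphabet (one {W} _)   = W
Alphabet (vec {W} _ _) = W
Alphabet (s ⊗ t)       = Alphabet s ⊎ Alphabet t

finite-Alphabet : ∀ s → Finite (Alphabet s)
finite-Alphabet (one F)   = F
finite-Alphabet (vec F _) = F
finite-Alphabet (s ⊗ t)   = finite-⊎ (finite-Alphabet s) (finite-Alphabet t)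

module _ {V W : Set} where

  mapSymbol : (V → W) → Symbol V → Symbol W
  mapSymbol e blank    = blank
  mapSymbol e (bit b)  = bit b
  mapSymbol e (work v) = work (e v)

  mapTape : (V → W) → Tape V → Tape W
  mapTape e (tape ls a rs) =
    tape (List.map (mapSymbol e) ls) (mapSymbol e a) (List.map (mapSymbol e) rs)

  -- Work symbols foreign to the tape are read as blanks, a default that does not occur on tapes
  -- encoded by `mapSymbol`.
  decodeSymbol : (W → Maybe V) → Symbol W → Symbol V
  decodeSymbol d blank    = blank
  decodeSymbol d (bit b)  = bit b
  decodeSymbol d (work w) = maybe work blank (d w)

  mapAction : (V → W) → Symbol W → Action V → Symbol W × Move
  mapAction e a (w , m) = maybe (mapSymbol e) a w , m

  move-mapTape : ∀ e m t → move m (mapTape e t) ≡ mapTape e (move m t)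
  move-mapTape e left  (tape []      a rs)      = refl
  move-mapTape e left  (tape (_ ∷ _) a rs)      = refl
  move-mapTape e stay  t                        = refl
  move-mapTape e right (tape ls      a [])      = refl
  move-mapTape e right (tape ls      a (_ ∷ _)) = refl

  act-mapTape : ∀ e a t →
    act (mapAction e (current (mapTape e t)) a) (mapTape e t) ≡ mapTape e (perform a t)
  act-mapTape e (nothing , m) t = move-mapTape e m t
  act-mapTape e (just a  , m) t = move-mapTape e m (write a t)

  readWord-mapTape : ∀ e t → readWord (mapTape e t) ≡ readWord t
  readWord-mapTape e t = bitPrefix-map (current t ∷ after t)
    where
    bitPrefix-map : ∀ as → bitPrefix (List.map (mapSymbol e) as) ≡ bitPrefix as
    bitPrefix-map []            = refl
    bitPrefix-map (blank ∷ as)  = refl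
    bitPrefix-map (bit b ∷ as)  = cong (b ∷_) (bitPrefix-map as)
    bitPrefix-map (work _ ∷ as) = refl

  decode-mapSymbol : ∀ {d e} → (∀ v → d (e v) ≡ just v) →
    ∀ a → decodeSymbol d (mapSymbol e a) ≡ a
  decode-mapSymbol p blank    = refl
  decode-mapSymbol p (bit b)  = refl
  decode-mapSymbol p (work v) = cong (maybe work blank) (p v)

  mapTape-wordTape : ∀ e x → mapTape e (wordTape x) ≡ wordTape x
  mapTape-wordTape e []      = refl
  mapTape-wordTape e (b ∷ x) = cong (tape [] (bit b)) (map-bit x)
    where
    map-bit : ∀ y → List.map (mapSymbol e) (List.map bit y) ≡ List.map bit y
    map-bit []      = refl
    map-bit (c ∷ y) = cong (bit c ∷_) (map-bit y)

take-++ : ∀ {A : Set} {m n} (xs : Vec A m) (ys : Vec A n) → Vec.take m (xs ++ ys) ≡ xs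
take-++ []       ys = refl
take-++ (x ∷ xs) ys = cong (x ∷_) (take-++ xs ys)

drop-++ : ∀ {A : Set} {m n} (xs : Vec A m) (ys : Vec A n) → Vec.drop m (xs ++ ys) ≡ ys
drop-++ []       ys = refl
drop-++ (x ∷ xs) ys = drop-++ xs ys

replicate-++ : ∀ {A : Set} {a : A} m {n} →
  Vec.replicate m a ++ Vec.replicate n a ≡ Vec.replicate (m ℕ.+ n) a
replicate-++ zero    = refl
replicate-++ (suc m) = cong (_ ∷_) (replicate-++ m)

module _ {A : Set} where

  -- The target alphabet is arbitrary so that the recursion can pass to components, composing `e`
  -- with the injections of the disjoint union.
  flatten : ∀ s → (Alphabet s → A) → Tapes s → Vec (Tape A) (size s)
  flatten (one _)   e t       = mapTape e t ∷ []
  flatten (vec _ n) e ts      = Vec.map (mapTape e) ts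
  flatten (s ⊗ t)   e (u , v) = flatten s (e ∘ inj₁) u ++ flatten t (e ∘ inj₂) v

  decode : ∀ s → (A → Maybe (Alphabet s)) → Vec (Symbol A) (size s) → Symbols s
  decode (one _)   d as = decodeSymbol d (Vec.head as)
  decode (vec _ n) d as = Vec.map (decodeSymbol d) as
  decode (s ⊗ t)   d as =
      decode s (λ a → d a >>= isInj₁) (Vec.take (size s) as)
    , decode t (λ a → d a >>= isInj₂) (Vec.drop (size s) as)

  flattenActions : ∀ s → (Alphabet s → A) → Vec (Symbol A) (size s) → Actions s →
                   Vec (Symbol A × Move) (size s)
  flattenActions (one _)   e as b         = mapAction e (Vec.head as) b ∷ []
  flattenActions (vec _ n) e as nothing   = Vec.map (_, stay) as
  flattenActions (vec _ n) e as (just bs) = Vec.zipWith (mapAction e) as bs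
  flattenActions (s ⊗ t)   e as (b , c)   =
    flattenActions s (e ∘ inj₁) (Vec.take (size s) as) b ++
    flattenActions t (e ∘ inj₂) (Vec.drop (size s) as) c

  private
    currents : ∀ s t e (u : Tapes s) (v : Tapes t) →
      Vec.map current (flatten (s ⊗ t) e (u , v)) ≡
      Vec.map current (flatten s (e ∘ inj₁) u) ++ Vec.map current (flatten t (e ∘ inj₂) v)
    currents s t e u v = Vec.map-++ current (flatten s (e ∘ inj₁) u) _

    take-currents : ∀ s t e (u : Tapes s) (v : Tapes t) →
      Vec.take (size s) (Vec.map current (flatten (s ⊗ t) e (u , v))) ≡
      Vec.map current (flatten s (e ∘ inj₁) u)
    take-currents s t e u v rewrite currents s t e u v = take-++ _ _

    drop-currents : ∀ s t e (u : Tapes s) (v : Tapes t) →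
      Vec.drop (size s) (Vec.map current (flatten (s ⊗ t) e (u , v))) ≡
      Vec.map current (flatten t (e ∘ inj₂) v)
    drop-currents s t e u v rewrite currents s t e u v =
      drop-++ (Vec.map current (flatten s (e ∘ inj₁) u)) _

  decode-flatten : ∀ s {d e} → (∀ v → d (e v) ≡ just v) → ∀ u →
    decode s d (Vec.map current (flatten s e u)) ≡ symbols s u
  decode-flatten (one _)   p t        = decode-mapSymbol p (current t)
  decode-flatten (vec _ _) p []       = refl
  decode-flatten (vec F _) p (t ∷ ts) =
    cong₂ _∷_ (decode-mapSymbol p (current t)) (decode-flatten (vec F _) p ts)
  decode-flatten (s ⊗ t) {d} {e} p (u , v)
    rewrite take-currents s t e u v | drop-currents s t e u v
    = cong₂ _,_ (decode-flatten s (λ a → cong (_>>= isInj₁) (p (inj₁ a))) u)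
                (decode-flatten t (λ a → cong (_>>= isInj₂) (p (inj₂ a))) v)

  flatten-performs : ∀ s e b u →
    Vec.zipWith act (flattenActions s e (Vec.map current (flatten s e u)) b) (flatten s e u) ≡
    flatten s e (performs s b u)
  flatten-performs (one _)   e b               t        = cong (_∷ []) (act-mapTape e b t)
  flatten-performs (vec F _) e nothing         []       = refl
  flatten-performs (vec F _) e nothing         (t ∷ ts) =
    cong (_ ∷_) (flatten-performs (vec F _) e nothing ts)
  flatten-performs (vec F _) e (just [])       []       = refl
  flatten-performs (vec F _) e (just (b ∷ bs)) (t ∷ ts) =
    cong₂ _∷_ (act-mapTape e b t) (flatten-performs (vec F _) e (just bs) ts)
  flatten-performs (s ⊗ t) e (b , c) (u , v)
    rewrite take-currents s t e u v | drop-currents s t e u v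
          | Vec.zipWith-++ act
              (flattenActions s (e ∘ inj₁) (Vec.map current (flatten s (e ∘ inj₁) u)) b)
              (flattenActions t (e ∘ inj₂) (Vec.map current (flatten t (e ∘ inj₂) v)) c)
              (flatten s (e ∘ inj₁) u) (flatten t (e ∘ inj₂) v)
    = cong₂ _++_ (flatten-performs s (e ∘ inj₁) b u) (flatten-performs t (e ∘ inj₂) c v)

  flatten-blanks : ∀ s e → flatten s e (blanks s) ≡ Vec.replicate (size s) blankTape
  flatten-blanks (one _)   e = refl
  flatten-blanks (vec _ n) e = Vec.map-replicate (mapTape e) blankTape n
  flatten-blanks (s ⊗ t)   e
    rewrite flatten-blanks s (e ∘ inj₁) | flatten-blanks t (e ∘ inj₂) = replicate-++ (size s)

module _ {s t : Shape} (M : Machine ((one finite-⊥ ⊗ s) ⊗ t)) where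

  private
    S = (one finite-⊥ ⊗ s) ⊗ t
    A = Alphabet S
    module M = Machine M
    open M using (_⟶_; step)

    Transitionᴰ : Set
    Transitionᴰ = M.State × Vec (Symbol A × Move) (size S)

    flat : Tapes S → Vec (Tape A) (size S)
    flat = flatten S id

    transitions : Vec (Symbol A) (size S) → Maybe (M.State × Actions S) → List Transitionᴰ
    transitions as nothing        = []
    transitions as (just (q , b)) = (q , flattenActions S id as b) ∷ []

    δᴰ : M.State → Vec (Symbol A) (size S) → List Transitionᴰ
    δᴰ q as = transitions as (M.δ q (decode S just as))

    machine : TM
    machine = record
      { State       = M.State
      ; Work        = A
      ; finiteState = M.finiteState
      ; finiteWork  = finite-Alphabet S
      ; workTapes   = size s ℕ.+ size t
      ; start       = M.start
      ; δ           = δᴰ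
      ; δ-unique    = λ q as → unique as (M.δ q (decode S just as))
      }
      where
      unique : ∀ as r → Unique (transitions as r)
      unique as nothing  = []
      unique as (just _) = [] ∷ []

    open TM machine hiding (δ; State)

    currents-decode : ∀ u → decode S just (Vec.map current (flat u)) ≡ symbols S u
    currents-decode = decode-flatten S (λ _ → refl)

    simulate-step : ∀ {q u q′ u′} → (q , u) ⟶ (q′ , u′) → config q (flat u) ⊢ config q′ (flat u′)
    simulate-step {q} {u} (step {a = b} eq)
      rewrite currents-decode u | eq = here (cong (config _) (sym (flatten-performs S id b u)))

    simulate : ∀ {q u q′ u′} → Star _⟶_ (q , u) (q′ , u′) →
               Star _⊢_ (config q (flat u)) (config q′ (flat u′))
    simulate ε        = ε
    simulate (p ◅ ps) = simulate-step p ◅ simulate ps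

  compile : DTM
  compile = record
    { machine       = machine
    ; deterministic = λ q as → short as (M.δ q (decode S just as))
    }
    where
    short : ∀ as r → List.length (transitions as r) ℕ.≤ 1
    short as nothing  = ℕ.z≤n
    short as (just _) = ℕ.s≤s ℕ.z≤n

  compile-outputs : ∀ {x w q} {u : Tapes S} →
    Star _⟶_ (M.start , ((wordTape x , blanks s) , blanks t)) (q , u) →
    M.δ q (symbols S u) ≡ nothing → readWord (proj₁ (proj₁ u)) ≡ w →
    Outputs compile x w
  compile-outputs {x} {q = q} {u = u} run halt out =
    config q (flat u)
    , subst (λ v → Star _⊢_ (config M.start v) (config q (flat u))) flat-initial (simulate run)
    , halted
    , trans (readWord-mapTape _ (proj₁ (proj₁ u))) out
    where
    flat-initial : flat ((wordTape x , blanks s) , blanks t) ≡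
                   wordTape x ∷ Vec.replicate (size s ℕ.+ size t) blankTape
    flat-initial = cong₂ _∷_ (mapTape-wordTape _ x) (trans
      (cong₂ _++_ (flatten-blanks s _) (flatten-blanks t _))
      (replicate-++ (size s)))
    halted : Halted (config q (flat u))
    halted rewrite currents-decode u | halt = refl

-- Integer counters

-- A counter is the position of the head relative to a mark.
counterTape : ℤ → Tape ⊤
counterTape (+ zero)  = tape [] (work tt) []
counterTape (+ suc n) = tape (List.replicate n blank List.++ work tt ∷ []) blank []
counterTape -[1+ n ]  = tape [] blank (List.replicate n blank List.++ work tt ∷ [])

increment decrement : ℤ → ℤ
increment (+ n)        = + suc n
increment -[1+ zero ]  = + zero
increment -[1+ suc n ] = -[1+ n ]
decrement (+ zero)     = -[1+ zero ]
decrement (+ suc n)    = + n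
decrement -[1+ n ]     = -[1+ suc n ]

nonNegative nonPositive : ℤ → Bool
nonNegative (+ _)     = true
nonNegative -[1+ _ ]  = false
nonPositive (+ zero)  = true
nonPositive (+ suc _) = false
nonPositive -[1+ _ ]  = true

-- The sign of a nonzero counter is invisible on the tape, so the control
-- remembers it; g is true for positive values.
SignOf : Bool → ℤ → Set
SignOf g (+ zero)  = ⊤
SignOf g (+ suc _) = g ≡ true
SignOf g -[1+ _ ]  = g ≡ false

record Counts (z : ℤ) (g : Bool) (t : Tape ⊤) : Set where
  constructor counts
  field
    similar : t ≈ counterTape z
    sign    : SignOf g z

-- The sign is set only when the head leaves the mark, to the direction of that step. On arrival at
-- the mark it keeps its old value, which `SignOf` ignores at zero.
newSign : Symbol ⊤ → Bool → Bool → Bool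
newSign (work _) d g = d
newSign _        d g = g

towards : Bool → Move
towards true  = right
towards false = left

shift : Bool → ℤ → ℤ
shift true  = increment
shift false = decrement

isMark : Symbol ⊤ → Bool
isMark (work _) = true
isMark _        = false

home : Symbol ⊤ → Bool → Move
home (work _) g = stay
home _        g = towards (not g)

approach : ℤ → ℤ
approach (+ zero)     = + zero
approach z@(+ suc _)  = decrement z
approach z@(-[1+ _ ]) = increment z

blank-≋ : ∀ {W : Set} → blank {W} ∷ [] ≋ []
blank-≋ zero    = refl
blank-≋ (suc n) = refl

move-counter : ∀ d z → move (towards d) (counterTape z) ≈ counterTape (shift d z)
move-counter true  (+ zero)        = ≈-refl
move-counter true  (+ suc n)       = ≈-refl
move-counter true  -[1+ zero ]     = ⟪ blank-≋ , refl , (λ _ → refl) ⟫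
move-counter true  -[1+ suc n ]    = ⟪ blank-≋ , refl , (λ _ → refl) ⟫
move-counter false (+ zero)        = ≈-refl
move-counter false (+ suc zero)    = ⟪ (λ _ → refl) , refl , blank-≋ ⟫
move-counter false (+ suc (suc n)) = ⟪ (λ _ → refl) , refl , blank-≋ ⟫
move-counter false -[1+ n ]        = ≈-refl

counts-shift : ∀ {z g t} d → Counts z g t →
               Counts (shift d z) (newSign (current t) d g) (move (towards d) t)
counts-shift {z} {g} d (counts p s) = counts
  (≈-trans (move-cong (towards d) p) (move-counter d z))
  (subst (λ a → SignOf (newSign a d g) (shift d z)) (sym (current-≡ p)) (signs d z s))
  where
  signs : ∀ d z → SignOf g z → SignOf (newSign (current (counterTape z)) d g) (shift d z)
  signs true  (+ zero)        s = refl
  signs true  (+ suc n)       s = s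
  signs true  -[1+ zero ]     s = tt
  signs true  -[1+ suc n ]    s = s
  signs false (+ zero)        s = refl
  signs false (+ suc zero)    s = tt
  signs false (+ suc (suc n)) s = s
  signs false -[1+ n ]        s = s

counts-approach : ∀ {z g t} → Counts z g t → Counts (approach z) g (move (home (current t) g) t)
counts-approach {z} {g} {t} (counts p s) = counts
  (≈-trans (move-cong (home (current t) g) p)
    (subst (λ a → move (home a g) (counterTape z) ≈ counterTape (approach z))
      (sym (current-≡ p)) (moved z s)))
  (signs z s)
  where
  moved : ∀ z → SignOf g z →
          move (home (current (counterTape z)) g) (counterTape z) ≈ counterTape (approach z)
  moved (+ zero)        s    = ≈-refl
  moved (+ suc n)       refl = move-counter false (+ suc n)
  moved -[1+ n ]        refl = move-counter true -[1+ n ]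
  signs : ∀ z → SignOf g z → SignOf g (approach z)
  signs (+ zero)        s = tt
  signs (+ suc zero)    s = tt
  signs (+ suc (suc n)) s = s
  signs -[1+ zero ]     s = tt
  signs -[1+ suc n ]    s = s

isNonNegative isNonPositive : Symbol ⊤ → Bool → Bool
isNonNegative a g = isMark a ∨ g
isNonPositive a g = isMark a ∨ not g

isZero : ℤ → Bool
isZero (+ zero)  = true
isZero (+ suc _) = false
isZero -[1+ _ ]  = false

counts-isZero : ∀ {z g t} → Counts z g t → isMark (current t) ≡ isZero z
counts-isZero {+ zero}   (counts p _) = cong isMark (current-≡ p)
counts-isZero {+ suc _}  (counts p _) = cong isMark (current-≡ p)
counts-isZero { -[1+ _ ]} (counts p _) = cong isMark (current-≡ p)

counts-nonNegative : ∀ {z g t} → Counts z g t → isNonNegative (current t) g ≡ nonNegative z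
counts-nonNegative {+ zero}    {g} (counts p _)    = cong (λ a → isNonNegative a g) (current-≡ p)
counts-nonNegative {+ suc _}   {g} (counts p refl) = cong (λ a → isNonNegative a g) (current-≡ p)
counts-nonNegative { -[1+ _ ]} {g} (counts p refl) = cong (λ a → isNonNegative a g) (current-≡ p)

counts-nonPositive : ∀ {z g t} → Counts z g t → isNonPositive (current t) g ≡ nonPositive z
counts-nonPositive {+ zero}    {g} (counts p _)    = cong (λ a → isNonPositive a g) (current-≡ p)
counts-nonPositive {+ suc _}   {g} (counts p refl) = cong (λ a → isNonPositive a g) (current-≡ p)
counts-nonPositive { -[1+ _ ]} {g} (counts p refl) = cong (λ a → isNonPositive a g) (current-≡ p)

-- Nondeterministic machines and the effect of their computation trees

-- With a accepting and r rejecting leaves seen since the last reset,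
-- excess = a - 2r and deficit = 2a - r.
record Tally : Set where
  constructor tally
  field
    excess deficit : ℤ
    some all       : Bool

open Tally public

addLeaf : Bool → Tally → Tally
addLeaf true  (tally i j f h) = tally (increment i) (increment (increment j)) f h
addLeaf false (tally i j f h) = tally (decrement (decrement i)) (decrement j) f h

-- For counters started at zero, `some` collects whether a probability of at least 2/3 has occurred
-- and `all` whether all have been at most 1/3. Resetting the counters makes the next tree start
-- afresh.
evaluate : Tally → Tally
evaluate (tally i j f h) = tally (+ 0) (+ 0) (f ∨ nonNegative i) (h ∧ nonPositive j)

evaluateIf : Bool → Tally → Tally
evaluateIf true  = evaluate
evaluateIf false = id

emptyTally : Tally
emptyTally = tally (+ 0) (+ 0) false true

record Nondeterministic (s : Shape) : Set₁ where
  field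
    State       : Set
    finiteState : Finite State
    start       : State
    δ           : State → Symbols s → List (State × Actions s)
    accepting   : State → Bool
    root        : State → Bool

  mutual
    -- The tally before and after a depth-first traversal of the computation
    -- tree below a configuration, where it is evaluated at roots.
    data Explored (q : State) (u : Tapes s) (X : Tally) : Tally → Set where
      leaf : δ q (symbols s u) ≡ [] → Explored q u X (addLeaf (accepting q) X)
      node : ∀ {r rs X′} → δ q (symbols s u) ≡ r ∷ rs → ExploredAll u (r ∷ rs) X X′ →
             Explored q u X (evaluateIf (root q) X′)

    data ExploredAll (u : Tapes s) : List (State × Actions s) → Tally → Tally → Set where
      []  : ∀ {X} → ExploredAll u [] X X
      _∷_ : ∀ {q a rs X Y Z} → Explored q (performs s a u) X Y → ExploredAll u rs Y Z →
            ExploredAll u ((q , a) ∷ rs) X Z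

  mutual
    -- A tree depends on the tapes only through the symbols scanned along its paths. This discards
    -- the blanks that rewinding a tape leaves behind.
    explored-resp : ∀ {q u v X Y} → Similar s u v → Explored q u X Y → Explored q v X Y
    explored-resp {q} p (leaf eq)    = leaf (trans (cong (δ q) (sym (symbols-cong s p))) eq)
    explored-resp {q} p (node eq es) =
      node (trans (cong (δ q) (sym (symbols-cong s p))) eq) (exploredAll-resp p es)

    exploredAll-resp : ∀ {u v rs X Y} → Similar s u v → ExploredAll u rs X Y → ExploredAll v rs X Y
    exploredAll-resp p []                     = []
    exploredAll-resp p (_∷_ {a = a} e es) =
      explored-resp (performs-cong s a p) e ∷ exploredAll-resp p es

-- Positions in lists

module _ {A : Set} where

  first : (as : List A) → Maybe (Fin (List.length as))
  first []      = nothing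
  first (_ ∷ _) = just zero

  next : (as : List A) → Fin (List.length as) → Maybe (Fin (List.length as))
  next (_ ∷ as) zero    = Maybe.map suc (first as)
  next (_ ∷ as) (suc i) = Maybe.map suc (next as i)

  remaining : (as : List A) → Fin (List.length as) → List A
  remaining (_ ∷ as) zero    = as
  remaining (_ ∷ as) (suc i) = remaining as i

  next-nothing : ∀ as i → next as i ≡ nothing → remaining as i ≡ []
  next-nothing (_ ∷ [])      zero    eq = refl
  next-nothing (_ ∷ (_ ∷ _)) zero    ()
  next-nothing (_ ∷ as)      (suc i) eq with next as i in e
  ... | nothing = next-nothing as i e

  next-just : ∀ as i {j} → next as i ≡ just j →
              remaining as i ≡ List.lookup as j ∷ remaining as j
  next-just (_ ∷ (_ ∷ _)) zero    refl = refl
  next-just (_ ∷ as)      (suc i) eq with next as i in e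
  next-just (_ ∷ as)      (suc i) refl | just j = next-just as i e

verdict : Bool → Bool → Word
verdict true  _     = 1b ∷ []
verdict false true  = 0b ∷ []
verdict false false = 1b ∷ 0b ∷ []

-- Depth-first search

module Search {s : Shape} (N : Nondeterministic (one finite-⊥ ⊗ s)) where

  open Nondeterministic N

  S₀ : Shape
  S₀ = one finite-⊥ ⊗ s

  -- To undo a transition it suffices to know the symbols it overwrote.
  Frame : Set
  Frame = Σ (State × Symbols S₀) λ (q , o) → Fin (List.length (δ q o))

  finite-Frame : Finite Frame
  finite-Frame = finite-Σ (finite-× finiteState (finite-Symbols S₀)) _

  S₂ : Shape
  S₂ = one finite-⊤ ⊗ one finite-⊤

  S₁ : Shape
  S₁ = one finite-Frame ⊗ S₂

  S : Shape
  S = S₀ ⊗ S₁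

  -- `forward q` enters a configuration with state `q`. `count b` is the second half of counting a
  -- leaf, since one of the two counters moves by two cells. The other control modes are numbered.
  Mode : Set
  Mode = State ⊎ (Bool ⊎ Fin 12)

  pattern forward q = inj₁ q
  pattern count b   = inj₂ (inj₁ b)
  pattern initial   = inj₂ (inj₂ zero)
  pattern pop       = inj₂ (inj₂ (suc zero))
  pattern restore   = inj₂ (inj₂ (suc (suc zero)))
  pattern advance   = inj₂ (inj₂ (suc (suc (suc zero))))
  pattern close     = inj₂ (inj₂ (suc (suc (suc (suc zero)))))
  pattern reset     = inj₂ (inj₂ (suc (suc (suc (suc (suc zero))))))
  pattern out₁      = inj₂ (inj₂ (suc (suc (suc (suc (suc (suc zero)))))))
  pattern out₂      = inj₂ (inj₂ (suc (suc (suc (suc (suc (suc (suc zero))))))))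
  pattern out₃      = inj₂ (inj₂ (suc (suc (suc (suc (suc (suc (suc (suc zero)))))))))
  pattern out₄      = inj₂ (inj₂ (suc (suc (suc (suc (suc (suc (suc (suc (suc zero))))))))))
  pattern out₅      = inj₂ (inj₂ (suc (suc (suc (suc (suc (suc (suc (suc (suc (suc zero)))))))))))
  pattern halt      = inj₂ (inj₂ (suc (suc (suc (suc (suc (suc (suc (suc (suc (suc (suc zero))))))))))))

  -- The signs of the two counters and the flags `some` and `all`.
  Registers : Set
  Registers = Bool × Bool × Bool × Bool

  Step : Set
  Step = Maybe ((Mode × Registers) × Actions S)

  goto : Mode → Registers → Action Frame → Step
  goto m ρ a = just ((m , ρ) , (skip S₀ , (a , skip S₂)))

  goLeft : ∀ {W} → Action W
  goLeft = nothing , left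

  frame : ∀ q o → Fin (List.length (δ q o)) → Frame
  frame q o i = (q , o) , i

  child : ∀ q o → Fin (List.length (δ q o)) → Registers → Step
  child q o i ρ = just ((forward (proj₁ r) , ρ) ,
                        (proj₂ r , ((just (work (frame q o i)) , right) , skip S₂)))
    where r = List.lookup (δ q o) i

  forwardStep : ∀ q o → Maybe (Fin (List.length (δ q o))) → Symbol ⊤ → Symbol ⊤ → Registers → Step
  forwardStep q o (just i) a₁ a₂ ρ                   = child q o i ρ
  forwardStep q o nothing  a₁ a₂ (g₁ , g₂ , f , h) =
    just ((count b , (newSign a₁ b g₁ , newSign a₂ b g₂ , f , h)) ,
          (skip S₀ , ((nothing , stay) , ((nothing , towards b) , (nothing , towards b)))))
    where b = accepting q

  popStep : Symbol Frame → Registers → Step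
  popStep (work ((q , o) , i)) ρ =
    just ((restore , ρ) , (moveBack S₀ (proj₂ (List.lookup (δ q o) i)) , (skip S₁)))
  popStep _                    ρ = goto out₁ ρ (nothing , stay)

  restoreStep : Symbol Frame → Registers → Step
  restoreStep (work ((q , o) , i)) ρ = just ((advance , ρ) , (overwrite S₀ o , (skip S₁)))
  restoreStep _                    ρ = nothing

  leaveStep : Bool → Registers → Step
  leaveStep true  ρ = goto close ρ (nothing , stay)
  leaveStep false ρ = goto pop ρ goLeft

  advanceStep : ∀ q o → Maybe (Fin (List.length (δ q o))) → Registers → Step
  advanceStep q o (just j) ρ = child q o j ρ
  advanceStep q o nothing  ρ = leaveStep (root q) ρ

  resetStep : Bool → Symbol ⊤ → Symbol ⊤ → Registers → Step
  resetStep true  a₁ a₂ ρ                     = goto pop ρ goLeft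
  resetStep false a₁ a₂ ρ@(g₁ , g₂ , f , h) =
    just ((reset , ρ) ,
          (skip S₀ , ((nothing , stay) , ((nothing , home a₁ g₁) , (nothing , home a₂ g₂)))))

  print : Mode → Registers → Action _ → Step
  print m ρ a = just ((m , ρ) , ((a , skip s) , skip S₁))

  step : Mode × Registers → Symbols S → Step
  step (initial , ρ) _ = just ((forward start , ρ) ,
    (skip S₀ , ((nothing , stay) , ((just (work tt) , stay) , (just (work tt) , stay)))))
  step (forward q , ρ) (o , (_ , (a₁ , a₂))) = forwardStep q o (first (δ q o)) a₁ a₂ ρ
  step (count true , (g₁ , g₂ , f , h)) (_ , (_ , (a₁ , a₂))) =
    just ((pop , (g₁ , newSign a₂ true g₂ , f , h)) ,
          (skip S₀ , (goLeft , ((nothing , stay) , (nothing , right)))))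
  step (count false , (g₁ , g₂ , f , h)) (_ , (_ , (a₁ , a₂))) =
    just ((pop , (newSign a₁ false g₁ , g₂ , f , h)) ,
          (skip S₀ , (goLeft , ((nothing , left) , (nothing , stay)))))
  step (pop , ρ)     (_ , (a , _)) = popStep a ρ
  step (restore , ρ) (_ , (a , _)) = restoreStep a ρ
  step (advance , ρ) (_ , (work ((q , o) , i) , _)) = advanceStep q o (next (δ q o) i) ρ
  step (advance , ρ) (_ , (_ , _)) = nothing
  step (close , (g₁ , g₂ , f , h)) (_ , (_ , (a₁ , a₂))) =
    goto reset (g₁ , g₂ , f ∨ isNonNegative a₁ g₁ , h ∧ isNonPositive a₂ g₂) (nothing , stay)
  step (reset , ρ) (_ , (_ , (a₁ , a₂))) = resetStep (isMark a₁ ∧ isMark a₂) a₁ a₂ ρ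
  -- The output overwrites the tape that held the input, so a blank must cut off old letters to its
  -- right before the head returns to the first bit.
  step (out₁ , ρ@(_ , _ , true  , _))     _ = print out₅ ρ (just (bit 1b) , right)
  step (out₁ , ρ@(_ , _ , false , true))  _ = print out₅ ρ (just (bit 0b) , right)
  step (out₁ , ρ@(_ , _ , false , false)) _ = print out₂ ρ (just (bit 1b) , right)
  step (out₂ , ρ) _ = print out₃ ρ (just (bit 0b) , right)
  step (out₃ , ρ) _ = print out₄ ρ (just blank , left)
  step (out₄ , ρ) _ = print halt ρ (nothing , left)
  step (out₅ , ρ) _ = print halt ρ (just blank , left)
  step (halt , ρ) _ = nothing

  finite-Mode : Finite Mode
  finite-Mode = finite-⊎ finiteState (finite-⊎ finite-Bool finite-Fin)

  finite-Registers : Finite Registers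
  finite-Registers = finite-× finite-Bool (finite-× finite-Bool (finite-× finite-Bool finite-Bool))

  machine : Machine S
  machine = record
    { State       = Mode × Registers
    ; finiteState = finite-× finite-Mode finite-Registers
    ; start       = initial , (true , true , false , true)
    ; δ           = step
    }

  open Machine machine using (_⟶_) renaming (step to steps)

  -- Correctness of the depth-first search

  Config : Set
  Config = (Mode × Registers) × Tapes S

  -- The stack lies strictly left of the head. The cells from the head on are unconstrained: they
  -- may hold stale frames, which a push overwrites.
  Below : List Frame → Tape Frame → Set
  Below π p = before p ≡ List.map work π

  Top : List Frame → Tape Frame → Set
  Top []      p = current p ≡ blank
  Top (x ∷ π) p = current p ≡ work x × before p ≡ List.map work π

  data Records (X : Tally) : Registers → Tapes S₂ → Set where
    records : ∀ {g₁ g₂ c₁ c₂} → Counts (excess X) g₁ c₁ → Counts (deficit X) g₂ c₂ →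
              Records X (g₁ , g₂ , some X , all X) (c₁ , c₂)

  -- The actual tapes `v` only resemble the ideal tapes `u` of the tree, because undoing is exact
  -- only up to trailing blanks.
  data At (m : Mode) (u : Tapes S₀) (P : Tape Frame → Set) (X : Tally) : Config → Set where
    at : ∀ {ρ v p cs} → Similar S₀ v u → P p → Records X ρ cs → At m u P X ((m , ρ) , (v , (p , cs)))

  Reaches : Config → (Config → Set) → Set
  Reaches c P = ∃ λ c′ → Star _⟶_ c c′ × P c′

  one-step : ∀ {c d P} → c ⟶ d → P d → Reaches c P
  one-step p q = _ , p ◅ ε , q

  infixl 5 _>=>_

  _>=>_ : ∀ {c P Q} → Reaches c P → (∀ {d} → P d → Reaches d Q) → Reaches c Q
  (_ , p , q) >=> f = _ , p ◅◅ proj₁ (proj₂ (f q)) , proj₂ (proj₂ (f q))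

  below-push : ∀ {π p} x → Below π p → Below (x ∷ π) (perform (just (work x) , right) p)
  below-push {p = tape ls a []}      x refl = refl
  below-push {p = tape ls a (_ ∷ _)} x refl = refl

  below-left : ∀ π {p} → Below π p → Top π (move left p)
  below-left []      {tape [] a rs}      refl = refl
  below-left (x ∷ π) {tape (_ ∷ _) a rs} refl = refl , refl

  similar-skip : ∀ {v u} → Similar S₀ v u → Similar S₀ (performs S₀ (skip S₀) v) u
  similar-skip {v} {u} = subst (λ w → Similar S₀ w u) (sym (performs-skip S₀ v))

  first-nothing : ∀ {A : Set} {as : List A} → as ≡ [] → first as ≡ nothing
  first-nothing refl = refl

  first-just : ∀ {A : Set} {as : List A} {r rs} → as ≡ r ∷ rs →
               ∃ λ i → first as ≡ just i × as ≡ List.lookup as i ∷ remaining as i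
  first-just refl = zero , refl , refl

  -- The index type of a frame depends on the observed symbols, so those of `v` and `u` have to be
  -- exchanged in the whole step at once.
  forward-step : ∀ {q v u m p c₁ c₂ ρ} → Similar S₀ v u → first (δ q (symbols S₀ u)) ≡ m →
    step (forward q , ρ) (symbols S (v , (p , (c₁ , c₂)))) ≡
    forwardStep q (symbols S₀ u) m (current c₁) (current c₂) ρ
  forward-step {q} {v} {p = p} {c₁} {c₂} {ρ} sim refl = observed (symbols-cong S₀ sim)
    where
    observed : ∀ {o} → symbols S₀ v ≡ o →
      step (forward q , ρ) (symbols S (v , (p , (c₁ , c₂)))) ≡
      forwardStep q o (first (δ q o)) (current c₁) (current c₂) ρ
    observed refl = refl

  advance-step : ∀ {q o i m a ρ y z} → a ≡ work (frame q o i) → next (δ q o) i ≡ m →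
                 step (advance , ρ) (y , (a , z)) ≡ advanceStep q o m ρ
  advance-step refl refl = refl

  visit-leaf : ∀ {q u π X c} → δ q (symbols S₀ u) ≡ [] → At (forward q) u (Below π) X c →
               Reaches c (At pop u (Top π) (addLeaf (accepting q) X))
  visit-leaf {q} {u} {π} {X} eq (at {v = v} {p} sim below (records {g₁} {g₂} {c₁} {c₂} k₁ k₂)) =
    second (accepting q) (steps (forward-step {p = p} {c₁ = c₁} {c₂ = c₂} sim (first-nothing eq)))
    where
    second : ∀ b {c} →
      c ⟶ ((count b , (newSign (current c₁) b g₁ , newSign (current c₂) b g₂ , some X , all X)) ,
            (performs S₀ (skip S₀) v , (p , (move (towards b) c₁ , move (towards b) c₂)))) →
      Reaches c (At pop u (Top π) (addLeaf b X))
    second true st = _ , st ◅ steps refl ◅ ε ,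
      at (similar-skip (similar-skip sim)) (below-left π below)
        (records (counts-shift true k₁) (counts-shift true (counts-shift true k₂)))
    second false st = _ , st ◅ steps refl ◅ ε ,
      at (similar-skip (similar-skip sim)) (below-left π below)
        (records (counts-shift false (counts-shift false k₁)) (counts-shift false k₂))

  reset-tally : ℤ → ℤ → Tally → Tally
  reset-tally i j (tally _ _ f h) = tally i j f h

  isZero⇒≡ : ∀ i → isZero i ≡ true → i ≡ + 0
  isZero⇒≡ (+ zero) refl = refl

  approach-∣∣ : ∀ i → ∣ approach i ∣ ≡ ℕ.pred ∣ i ∣
  approach-∣∣ (+ zero)     = refl
  approach-∣∣ (+ suc _)    = refl
  approach-∣∣ -[1+ zero ]  = refl
  approach-∣∣ -[1+ suc _ ] = refl

  -- Induction on a common bound for the distances of both heads from their marks. A head that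
  -- arrives early waits, as `approach` fixes zero.
  leave-reset : ∀ n {u π X c} → ∣ excess X ∣ ℕ.≤ n → ∣ deficit X ∣ ℕ.≤ n →
    At reset u (Below π) X c → Reaches c (At pop u (Top π) (reset-tally (+ 0) (+ 0) X))
  leave-reset n {u} {π} {X} ≤₁ ≤₂ (at {v = v} {p} sim below (records {g₁} {g₂} {c₁} {c₂} k₁ k₂))
    with isMark (current c₁) ∧ isMark (current c₂) in e
  ... | true = _ , steps (cong (λ b → resetStep b _ _ _) e) ◅ ε ,
    at (similar-skip sim) (below-left π below) (records (at-zero k₁ e₁) (at-zero k₂ e₂))
    where
    ∧-true : ∀ {a b} → a ∧ b ≡ true → a ≡ true × b ≡ true
    ∧-true {true} p = refl , p
    e₁ = proj₁ (∧-true e)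
    e₂ = proj₂ (∧-true {isMark (current c₁)} e)
    at-zero : ∀ {z g t} → Counts z g t → isMark (current t) ≡ true → Counts (+ 0) g t
    at-zero {z} k eq = subst (λ i → Counts i _ _)
      (isZero⇒≡ z (trans (sym (counts-isZero k)) eq)) k
  leave-reset zero {u} {π} {X} ≤₁ ≤₂ (at {v = v} {p} sim below (records {g₁} {g₂} {c₁} {c₂} k₁ k₂))
    | false with trans (sym e) (cong₂ _∧_ (zero-mark k₁ ≤₁) (zero-mark k₂ ≤₂))
    where
    zero-mark : ∀ {z g t} → Counts z g t → ∣ z ∣ ℕ.≤ 0 → isMark (current t) ≡ true
    zero-mark {+ zero} k _ = counts-isZero k
  ... | ()
  leave-reset (suc n) {u} {π} {X} ≤₁ ≤₂ (at {v = v} {p} sim below (records {g₁} {g₂} {c₁} {c₂} k₁ k₂))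
    | false =
    one-step (steps (cong (λ b → resetStep b _ _ _) e))
      (at {X = reset-tally (approach (excess X)) (approach (deficit X)) X}
        (similar-skip sim) below (records (counts-approach k₁) (counts-approach k₂)))
    >=> leave-reset n {X = reset-tally (approach (excess X)) (approach (deficit X)) X}
          (smaller (excess X) ≤₁) (smaller (deficit X) ≤₂)
    where
    smaller : ∀ z {n} → ∣ z ∣ ℕ.≤ suc n → ∣ approach z ∣ ℕ.≤ n
    smaller z p rewrite approach-∣∣ z = ℕ.pred-mono-≤ p

  -- The equation for the step is left to the caller, who knows the frame under the head; here only
  -- the stack below it matters.
  leave-node : ∀ {u π X c} q → At advance u (Below π) X c →
    (∀ {ρ v p cs} → c ≡ ((advance , ρ) , (v , (p , cs))) →
      step (advance , ρ) (symbols S (v , (p , cs))) ≡ leaveStep (root q) ρ) →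
    Reaches c (At pop u (Top π) (evaluateIf (root q) X))
  leave-node {u} {π} {X} q (at {ρ} {v} {p} {cs} sim below r@(records {g₁} {g₂} {c₁} {c₂} k₁ k₂)) eq =
    leave (root q) (λ e → steps (trans (eq refl) e))
    where
    leave : ∀ b → (∀ {m a} → leaveStep b ρ ≡ just (m , a) →
                   ((advance , ρ) , (v , (p , cs))) ⟶ (m , performs S a (v , (p , cs)))) →
      Reaches ((advance , ρ) , (v , (p , cs))) (At pop u (Top π) (evaluateIf b X))
    leave false st = one-step (st refl) (at (similar-skip sim) (below-left π below) r)
    leave true  st = _ , st refl ◅ steps refl ◅ proj₁ (proj₂ rest) , proj₂ (proj₂ rest)
      where
      f h : Bool
      f = some X ∨ isNonNegative (current c₁) g₁
      h = all X ∧ isNonPositive (current c₂) g₂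
      flags : Records (reset-tally (excess X) (deficit X) (evaluate X)) (g₁ , g₂ , f , h) cs
      flags rewrite counts-nonNegative k₁ | counts-nonPositive k₂ = records k₁ k₂
      rest = leave-reset (∣ excess X ∣ ℕ.+ ∣ deficit X ∣) (ℕ.m≤m+n _ _) (ℕ.m≤n+m _ _)
        (at (similar-skip (similar-skip sim)) below flags)

  module _ {u : Tapes S₀} {π : List Frame} (q : State) where

    private
      o = symbols S₀ u
      n = List.length (δ q o)

    AtFrame : Mode → Tapes S₀ → Fin n → Tally → Config → Set
    AtFrame m v i = At m v (Top (frame q o i ∷ π))

    leave-frame : ∀ {i X c} → next (δ q o) i ≡ nothing → AtFrame advance u i X c →
      Reaches c (At pop u (Top π) (evaluateIf (root q) X))
    leave-frame {i} last c@(at sim (≡x , below) r) =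
      leave-node q (at sim below r) λ { refl → advance-step ≡x last }

    -- A transition writes and then moves, so its inverse must move and then write. This is why
    -- `pop` and `restore` are separate modes.
    undo : ∀ {i X c} → AtFrame pop (performs S₀ (proj₂ (List.lookup (δ q o) i)) u) i X c →
      Reaches c (AtFrame advance u i X)
    undo {i} (at {ρ} {v} {p} {cs} sim (≡x , below) r) =
      _ , steps (cong (λ a → popStep a ρ) ≡x) ◅ steps (cong (λ a → restoreStep a ρ) ≡x) ◅ ε ,
      at (similar-trans S₀
           (performs-cong S₀ (overwrite S₀ o) (performs-cong S₀ (moveBack S₀ a) sim))
           (performs-undo S₀ a u))
         (≡x , below) (skipped r)
      where
      a = proj₂ (List.lookup (δ q o) i)
      skipped : ∀ {X ρ cs} → Records X ρ cs →
                Records X ρ (performs S₂ (skip S₂) (performs S₂ (skip S₂) cs))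
      skipped (records k₁ k₂) = records k₁ k₂

    descend : ∀ {i m X c} →
      At m u (Below π) X c →
      (∀ {ρ v p cs} → c ≡ ((m , ρ) , (v , (p , cs))) →
        step (m , ρ) (symbols S (v , (p , cs))) ≡ child q o i ρ) →
      Reaches c (At (forward (proj₁ (List.lookup (δ q o) i)))
                    (performs S₀ (proj₂ (List.lookup (δ q o) i)) u) (Below (frame q o i ∷ π)) X)
    descend {i} (at {p = p} sim below (records k₁ k₂)) eq =
      one-step (steps (eq refl)) (at (performs-cong S₀ (proj₂ (List.lookup (δ q o) i)) sim)
        (below-push {p = p} (frame q o i) below) (records k₁ k₂))

  mutual
    -- Structural recursion on the tree, which is where termination of the search comes from. Each
    -- visit ends with tapes and stack as it found them, so the parent can undo its transition and
    -- try the next child.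
    visit : ∀ {q u π X Y c} → Explored q u X Y → At (forward q) u (Below π) X c →
      Reaches c (At pop u (Top π) Y)
    visit (leaf eq) c = visit-leaf eq c
    visit {q} {u} (node eq es) c@(at sim _ _) with first-just eq
    ... | i , e , split = descend q c
            (λ { {p = p} {c₁ , c₂} refl → forward-step {p = p} {c₁ = c₁} {c₂ = c₂} sim e })
      >=> visit-from q i (trans (sym eq) split) es

    visit-from : ∀ {u π X Y c rs} q i →
      rs ≡ List.lookup (δ q (symbols S₀ u)) i ∷ remaining (δ q (symbols S₀ u)) i →
      ExploredAll u rs X Y →
      At (forward (proj₁ (List.lookup (δ q (symbols S₀ u)) i)))
         (performs S₀ (proj₂ (List.lookup (δ q (symbols S₀ u)) i)) u)
         (Below (frame q (symbols S₀ u) i ∷ π)) X c →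
      Reaches c (At pop u (Top π) (evaluateIf (root q) Y))
    visit-from q i refl (e ∷ es) c = visit e c >=> undo q >=> visit-rest q i refl es

    visit-rest : ∀ {u π X Y c rs} q i → rs ≡ remaining (δ q (symbols S₀ u)) i →
      ExploredAll u rs X Y → At advance u (Top (frame q (symbols S₀ u) i ∷ π)) X c →
      Reaches c (At pop u (Top π) (evaluateIf (root q) Y))
    visit-rest {u} q i eq es c with next (δ q (symbols S₀ u)) i in e
    visit-rest {u} q i eq es c | nothing with trans eq (next-nothing (δ q (symbols S₀ u)) i e) | es
    ... | refl | [] = leave-frame q e c
    visit-rest {u} q i eq es (at sim (≡x , below) r) | just j =
      descend q (at sim below r) (λ { refl → advance-step ≡x e })
      >=> visit-from q j (trans eq (next-just (δ q (symbols S₀ u)) i e)) es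

  decider : DTM
  decider = compile {s} {S₁} machine

  search-outputs : ∀ {x Y} → Explored start (wordTape x , blanks s) emptyTally Y →
    Outputs decider x (verdict (some Y) (all Y))
  search-outputs {x} {Y} e = finish (proj₂ searched)
    where
    c₀ : Config
    c₀ = (initial , (true , true , false , true)) , ((wordTape x , blanks s) , blanks S₁)
    searched : Reaches c₀ (At pop (wordTape x , blanks s) (Top []) Y)
    searched = one-step (steps refl)
        (at (similar-reflexive (performs-skip S₀ (wordTape x , blanks s))) refl
          (records (counts ≈-refl tt) (counts ≈-refl tt)))
      >=> visit e
      where
      similar-reflexive : ∀ {v u} → v ≡ u → Similar S₀ v u
      similar-reflexive refl = similar-refl S₀
    finish : ∀ {c} → Star _⟶_ c₀ c × At pop (wordTape x , blanks s) (Top []) Y c →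
      Outputs decider x (verdict (some Y) (all Y))
    finish (run , at {v = t , _} {p} _ ≡blank (records _ _)) = print-verdict (some Y) (all Y) t
        (run ◅◅ (steps (cong (λ a → popStep a _) ≡blank) ◅ ε))
      where
      -- The cases differ in how many cells are listed right of the head, on which the reduction of
      -- the right moves depends.
      print-verdict : ∀ f h t {g₁ g₂ u w} →
        Star _⟶_ c₀ ((out₁ , (g₁ , g₂ , f , h)) , ((t , u) , w)) →
        Outputs decider x (verdict f h)
      print-verdict true h (tape ls a []) run =
        compile-outputs machine (run ◅◅ (steps refl ◅ steps refl ◅ ε)) refl refl
      print-verdict true h (tape ls a (_ ∷ _)) run =
        compile-outputs machine (run ◅◅ (steps refl ◅ steps refl ◅ ε)) refl refl
      print-verdict false true (tape ls a []) run =
        compile-outputs machine (run ◅◅ (steps refl ◅ steps refl ◅ ε)) refl refl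
      print-verdict false true (tape ls a (_ ∷ _)) run =
        compile-outputs machine (run ◅◅ (steps refl ◅ steps refl ◅ ε)) refl refl
      print-verdict false false (tape ls a []) run =
        compile-outputs machine
          (run ◅◅ (steps refl ◅ steps refl ◅ steps refl ◅ steps refl ◅ ε)) refl refl
      print-verdict false false (tape ls a (_ ∷ [])) run =
        compile-outputs machine
          (run ◅◅ (steps refl ◅ steps refl ◅ steps refl ◅ steps refl ◅ ε)) refl refl
      print-verdict false false (tape ls a (_ ∷ _ ∷ _)) run =
        compile-outputs machine
          (run ◅◅ (steps refl ◅ steps refl ◅ steps refl ◅ steps refl ◅ ε)) refl refl

-- Tapes carrying words

module _ {W : Set} where

  -- The head is at the end of a word, given from right to left.
  endTape : Word → Tape W
  endTape w = tape (List.map bit w) blank []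

  suffixTape : List (Symbol W) → Word → Tape W
  suffixTape ls []      = tape ls blank []
  suffixTape ls (b ∷ w) = tape ls (bit b) (List.map bit w)

  -- The head is on the last letter of a word, given from right to left.
  lastTape : Word → List (Symbol W) → Tape W
  lastTape []      rs = tape [] blank rs
  lastTape (b ∷ w) rs = tape (List.map bit w) (bit b) rs

  wordTape-suffix : ∀ w → wordTape w ≡ suffixTape [] w
  wordTape-suffix []      = refl
  wordTape-suffix (_ ∷ _) = refl

  move-suffix : ∀ ls b w → move right (suffixTape ls (b ∷ w)) ≡ suffixTape (bit b ∷ ls) w
  move-suffix ls b []      = refl
  move-suffix ls b (_ ∷ _) = refl

  move-end : ∀ w → move left (endTape w) ≡ lastTape w (blank ∷ [])
  move-end []      = refl
  move-end (_ ∷ _) = refl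

  move-last : ∀ b w rs → move left (lastTape (b ∷ w) rs) ≡ lastTape w (bit b ∷ rs)
  move-last b []      rs = refl
  move-last b (_ ∷ _) rs = refl

  rewound : ∀ w → move right (tape [] blank (List.map bit w List.++ blank ∷ [])) ≈ wordTape {W} w
  rewound []      = ⟪ blank-≋ , refl , (λ _ → refl) ⟫
  rewound (b ∷ w) = ⟪ blank-≋ , refl , trailing (List.map bit w) ⟫
    where
    trailing : ∀ as → as List.++ blank ∷ [] ≋ as
    trailing []       n       = blank-≋ n
    trailing (_ ∷ as) zero    = refl
    trailing (_ ∷ as) (suc n) = trailing as n

-- Little-endian binary numerals

pad : Bit → ℕ → Word → Word
pad b zero    w = w
pad b (suc k) w = pad b k (b ∷ w)

-- Schoolbook borrowing in least-significant-first order: each low zero becomes a one. In the step,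
-- doubling `suc n` gives `2 + 2n`, which is one more than the odd number `1 + 2n`.
fromDigits-borrow : ∀ k v w → fromDigits v ≡ suc (fromDigits w) →
                    fromDigits (pad 0b k v) ≡ suc (fromDigits (pad 1b k w))
fromDigits-borrow zero    v w eq = eq
fromDigits-borrow (suc k) v w eq =
  fromDigits-borrow k (0b ∷ v) (1b ∷ w) (cong (ℕ._* 2) eq)

fromDigits-zeros : ∀ k w → fromDigits w ≡ 0 → fromDigits (pad 0b k w) ≡ 0
fromDigits-zeros zero    w eq = eq
fromDigits-zeros (suc k) w eq = fromDigits-zeros k (0b ∷ w) (cong (ℕ._* 2) eq)

doubled : Word → Word
doubled []      = []
doubled (b ∷ x) = 1b ∷ b ∷ doubled x

pair-doubled : ∀ x y → ⟨ x , y ⟩ ≡ doubled x List.++ 0b ∷ y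
pair-doubled []      y = refl
pair-doubled (b ∷ x) y = cong (λ w → 1b ∷ b ∷ w) (pair-doubled x y)

labels : (M : TM) → List (TM.Config M) → List Bool
labels M = List.map (does ∘ TM.accepting? M)

addLeaves : List Bool → Tally → Tally
addLeaves []       X = X
addLeaves (b ∷ bs) X = addLeaves bs (addLeaf b X)

addLeaves-++ : ∀ bs cs X → addLeaves (bs List.++ cs) X ≡ addLeaves cs (addLeaves bs X)
addLeaves-++ []       cs X = refl
addLeaves-++ (b ∷ bs) cs X = addLeaves-++ bs cs (addLeaf b X)

throughVec : ∀ n → (Vec Bit n → Tally → Tally) → Tally → Tally
throughVec zero    F X = F [] X
throughVec (suc n) F X = throughVec n (F ∘ (1b ∷_)) (throughVec n (F ∘ (0b ∷_)) X)

-- The machines traversed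

-- Started in `copy`, the machine copies its input x to the input tape of M and
-- runs M.  Started in `pair`, it prepares ⟨ x , y ⟩ for a guessed y whose length
-- is computed by D: the output of D becomes a counter that is decremented
-- (`borrow`) before each bit is guessed.

module Guessing (D : DTM) (M : TM) where

  private
    module D = TM (DTM.machine D)
    module M = TM M

  s : Shape
  s = (one D.finiteWork ⊗ vec D.finiteWork D.workTapes) ⊗
      ((one M.finiteWork ⊗ vec M.finiteWork M.workTapes) ⊗ one finite-⊥)

  S : Shape
  S = one finite-⊥ ⊗ s

  State : Set
  State = D.State ⊎ (M.State ⊎ Fin 12)

  pattern runD q  = inj₁ q
  pattern runM q  = inj₂ (inj₁ q)
  pattern copy    = inj₂ (inj₂ zero)
  pattern pair    = inj₂ (inj₂ (suc zero))
  pattern pair′   = inj₂ (inj₂ (suc (suc zero)))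
  pattern rewindD = inj₂ (inj₂ (suc (suc (suc zero))))
  pattern fetch   = inj₂ (inj₂ (suc (suc (suc (suc zero)))))
  pattern borrow  = inj₂ (inj₂ (suc (suc (suc (suc (suc zero))))))
  pattern guess   = inj₂ (inj₂ (suc (suc (suc (suc (suc (suc zero)))))))
  pattern rewindM = inj₂ (inj₂ (suc (suc (suc (suc (suc (suc (suc zero))))))))
  pattern launch  = inj₂ (inj₂ (suc (suc (suc (suc (suc (suc (suc (suc zero)))))))))
  pattern inspect = inj₂ (inj₂ (suc (suc (suc (suc (suc (suc (suc (suc (suc zero))))))))))
  pattern accept  = inj₂ (inj₂ (suc (suc (suc (suc (suc (suc (suc (suc (suc (suc zero)))))))))))
  pattern reject  = inj₂ (inj₂ (suc (suc (suc (suc (suc (suc (suc (suc (suc (suc (suc zero))))))))))))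

  copying pairing : State
  copying = copy
  pairing = pair

  -- A separate state marks the roots: `runM M.start` could be reentered during a run, and it would
  -- be followed by the evaluation of a subtree at each visit.
  isRoot : State → Bool
  isRoot launch = true
  isRoot _     = false

  isAccepting : State → Bool
  isAccepting accept = true
  isAccepting _      = false

  Steps : Set
  Steps = List (State × Actions S)

  none : ∀ {W} → Action W
  none = nothing , stay

  go : ∀ {W} → Move → Action W
  go m = nothing , m

  put : ∀ {W} → Bit → Move → Action W
  put b m = just (bit b) , m

  to : State → Action _ → Action D.Work → Action M.Work → Action _ → State × Actions S
  to q i d m c = q , (i , ((d , nothing) , ((m , nothing) , c)))

  lift : ∀ {W} → Symbol W × Move → Action W
  lift (a , m) = just a , m

  liftD : D.Transition → State × Actions S
  liftD (q , a ∷ as) =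
    runD q , (none , ((lift a , just (Vec.map lift as)) , ((none , nothing) , none)))

  liftM : M.Transition → State × Actions S
  liftM (q , a ∷ as) =
    runM q , (none , ((none , nothing) , ((lift a , just (Vec.map lift as)) , none)))

  stepsD : List D.Transition → Steps
  stepsD []         = to fetch none none none none ∷ []
  stepsD ts@(_ ∷ _) = List.map liftD ts

  -- The output is the word 1 exactly if the scanned cell holds 1 and its right neighbour holds no
  -- bit; `inspect` examines the neighbour. These extra steps do not branch, so the number of leaves
  -- is preserved.
  haltM : Symbol M.Work → Steps
  haltM (bit (suc zero)) = to inspect none none (go right) none ∷ []
  haltM _                = to reject none none none none ∷ []

  stepsM : List M.Transition → Symbol M.Work → Steps
  stepsM []         m = haltM m
  stepsM ts@(_ ∷ _) m = List.map liftM ts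

  δ : State → Symbols S → Steps
  δ copy (bit b , _) = to copy (go right) none (put b right) none ∷ []
  δ copy _           = to rewindM none none (go left) none ∷ []
  δ pair (bit b , _) = to pair′ none none (put 1b right) none ∷ []
  δ pair _           = to rewindD none (go left) (put 0b right) none ∷ []
  δ pair′ (bit b , _) = to pair (go right) (put b right) (put b right) none ∷ []
  -- A default: `pair` enters `pair′` with the input head still on the bit just read.
  δ pair′ _           = []
  δ rewindD (_ , ((bit _ , _) , _)) = to rewindD none (go left) none none ∷ []
  δ rewindD _                       = to (runD D.start) none (go right) none none ∷ []
  δ (runD q) (_ , ((d , ds) , _)) = stepsD (D.δ q (d ∷ ds))
  δ fetch (_ , ((bit b , _) , _)) = to fetch none (go right) none (put b right) ∷ []
  δ fetch _                       = to borrow none none none (go left) ∷ []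
  δ borrow (_ , (_ , (_ , bit zero)))       = to borrow none none none (put 1b left) ∷ []
  δ borrow (_ , (_ , (_ , bit (suc zero)))) = to guess none none none (put 0b stay) ∷ []
  δ borrow _                                = to rewindM none none (go left) none ∷ []
  δ guess (_ , (_ , (_ , bit _))) = to guess none none none (go right) ∷ []
  -- The only branching before `launch`, as `D` is deterministic. The order 0, 1 is that of
  -- `throughVec`.
  δ guess _                       = to borrow none none (put 0b right) (go left) ∷
                                    to borrow none none (put 1b right) (go left) ∷ []
  δ rewindM (_ , (_ , ((bit _ , _) , _))) = to rewindM none none (go left) none ∷ []
  δ rewindM _                             = to launch none none (go right) none ∷ []
  δ launch _ = to (runM M.start) none none none none ∷ []
  δ (runM q) (_ , (_ , ((m , ms) , _))) = stepsM (M.δ q (m ∷ ms)) m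
  δ inspect (_ , (_ , ((bit _ , _) , _))) = to reject none none none none ∷ []
  δ inspect _                             = to accept none none none none ∷ []
  δ accept _ = []
  δ reject _ = []

  machine : State → Nondeterministic S
  machine q = record
    { State       = State
    ; finiteState = finite-⊎ D.finiteState (finite-⊎ M.finiteState finite-Fin)
    ; start       = q
    ; δ           = δ
    ; accepting   = isAccepting
    ; root        = isRoot
    }

  TapesD TapesM : Set
  TapesD = Tape D.Work × Vec (Tape D.Work) D.workTapes
  TapesM = Tape M.Work × Vec (Tape M.Work) M.workTapes

  -- Computation trees of the guessing machine

  module Exploration (q₀ : State) where

    open Nondeterministic (machine q₀)
      using (Explored; ExploredAll; leaf; node; []; _∷_; explored-resp)

    -- Trees are assembled backwards, from the later configuration to the earlier one. A node with
    -- one child that is not a root leaves the tally alone.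
    follow : ∀ {q u q′ a X Y} → isRoot q ≡ false → δ q (symbols S u) ≡ (q′ , a) ∷ [] →
      Explored q′ (performs S a u) X Y → Explored q u X Y
    follow {q} root eq e = subst (λ b → Explored q _ _ (evaluateIf b _)) root (node eq (e ∷ []))

    module _ {i c : Tape ⊥} {d : Tape D.Work} {ds : Vec (Tape D.Work) D.workTapes}
             {ms : Vec (Tape M.Work) M.workTapes} {X Y : Tally} where

      rewind-M : ∀ w v → Explored launch (i , ((d , ds) , ((wordTape (w ʳ++ v) , ms) , c))) X Y →
        Explored rewindM (i , ((d , ds) , ((lastTape w (List.map bit v List.++ blank ∷ []) , ms) , c))) X Y
      rewind-M []      v e = follow refl refl (explored-resp
        (≈-refl , (similar-refl (one D.finiteWork ⊗ vec D.finiteWork _) ,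
          ((≈-sym (rewound {M.Work} v) , similar-refl (vec M.finiteWork _)) , ≈-refl))) e)
      rewind-M (b ∷ w) v e = follow refl refl
        (subst (λ t → Explored rewindM (i , ((d , ds) , ((t , ms) , c))) X Y)
          (sym (move-last b w _)) (rewind-M w (b ∷ v) e))

      rewind-end-M : ∀ w → Explored launch (i , ((d , ds) , ((wordTape (w ʳ++ []) , ms) , c))) X Y →
        Explored rewindM (i , ((d , ds) , ((move left (endTape w) , ms) , c))) X Y
      rewind-end-M w e = subst (λ t → Explored rewindM (i , ((d , ds) , ((t , ms) , c))) X Y)
        (sym (move-end w)) (rewind-M w [] e)

    module _ {i c : Tape ⊥} {ds : Vec (Tape D.Work) D.workTapes} {m : TapesM} {X Y : Tally} where

      rewind-D : ∀ w v → Explored (runD D.start) (i , ((wordTape (w ʳ++ v) , ds) , (m , c))) X Y →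
        Explored rewindD (i , ((lastTape w (List.map bit v List.++ blank ∷ []) , ds) , (m , c))) X Y
      rewind-D []      v e = follow refl refl (explored-resp
        (≈-refl , ((≈-sym (rewound {D.Work} v) , similar-refl (vec D.finiteWork _)) ,
          (similar-refl (one M.finiteWork ⊗ vec M.finiteWork _) , ≈-refl))) e)
      rewind-D (b ∷ w) v e = follow refl refl
        (subst (λ t → Explored rewindD (i , ((t , ds) , (m , c))) X Y)
          (sym (move-last b w _)) (rewind-D w (b ∷ v) e))

      rewind-end-D : ∀ w → Explored (runD D.start) (i , ((wordTape (w ʳ++ []) , ds) , (m , c))) X Y →
        Explored rewindD (i , ((move left (endTape w) , ds) , (m , c))) X Y
      rewind-end-D w e = subst (λ t → Explored rewindD (i , ((t , ds) , (m , c))) X Y)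
        (sym (move-end w)) (rewind-D w [] e)

    -- The final input tape is left general by `∀ i`, since the states from `launch` on do not
    -- inspect it.
    copy-input : ∀ {d ds ms c X Y} x {ls w} →
      (∀ i → Explored launch (i , ((d , ds) , ((wordTape ((x ʳ++ w) ʳ++ []) , ms) , c))) X Y) →
      Explored copy (suffixTape ls x , ((d , ds) , ((endTape w , ms) , c))) X Y
    copy-input []      {w = w} e = follow refl refl (rewind-end-M w (e _))
    copy-input {d} {ds} {ms} {c} {X} {Y} (b ∷ x) {ls} {w} e = follow refl refl
      (subst (λ i → Explored copy (i , ((d , ds) , ((endTape (b ∷ w) , ms) , c))) X Y)
        (sym (move-suffix ls b x)) (copy-input x e))

    pair-input : ∀ {ds ms c X Y} x {ls v w} →
      (∀ i → Explored (runD D.start)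
        (i , ((wordTape ((x ʳ++ v) ʳ++ []) , ds) , ((endTape (0b ∷ (doubled x ʳ++ w)) , ms) , c))) X Y) →
      Explored pair (suffixTape ls x , ((endTape v , ds) , ((endTape w , ms) , c))) X Y
    pair-input []      {v = v} e = follow refl refl (rewind-end-D v (e _))
    pair-input {ds} {ms} {c} {X} {Y} (b ∷ x) {ls} {v} {w} e = follow refl refl (follow refl refl
      (subst (λ i → Explored pair (i , ((endTape (b ∷ v) , ds) , ((endTape (b ∷ 1b ∷ w) , ms) , c))) X Y)
        (sym (move-suffix ls b x)) (pair-input x e)))

    perform-lift : ∀ {W n} (as : Vec (Symbol W × Move) n) ts →
                   Vec.zipWith perform (Vec.map lift as) ts ≡ Vec.zipWith act as ts
    perform-lift []       []       = refl
    perform-lift (_ ∷ as) (_ ∷ ts) = cong (_ ∷_) (perform-lift as ts)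

    map-≡-[] : ∀ {A B : Set} {f : A → B} as → List.map f as ≡ [] → as ≡ []
    map-≡-[] [] _ = refl

    only-member : ∀ {A B : Set} {f : A → B} as {b} → b ∈ List.map f as → List.length as ℕ.≤ 1 →
                  ∃ λ a → as ≡ a ∷ [] × b ≡ f a
    only-member (a ∷ [])    (here eq) _         = a , refl , eq
    only-member (_ ∷ _ ∷ _) _         (s≤s ())

    onD : Tape ⊥ → D.Config → TapesM × Tape ⊥ → Tapes S
    onD i c m = i , ((Vec.head (tapes c) , Vec.tail (tapes c)) , m)

    onM : Tape ⊥ → TapesD → M.Config → Tape ⊥ → Tapes S
    onM i d c b = i , (d , ((Vec.head (tapes c) , Vec.tail (tapes c)) , b))

    -- By determinism each configuration on the given path has the next one as its only child, so
    -- the path is the whole tree down to `fetch`.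
    run-D : ∀ {i m X Y c c′} → Star D._⊢_ c c′ → D.Halted c′ →
      Explored fetch (onD i c′ m) X Y → Explored (runD (state c)) (onD i c m) X Y
    run-D {c = config q (t ∷ ts)} ε halted e = follow refl (cong stepsD (map-≡-[] _ halted)) e
    run-D {i} {m} {X} {Y} {c = config q (t ∷ ts)} (step ◅ run) halted e
      with only-member (D.δ q (current t ∷ Vec.map current ts)) step (DTM.deterministic D q _)
    ... | (q′ , a ∷ as) , eq , refl = follow refl (cong stepsD eq)
      (subst (λ us → Explored (runD q′) (i , ((act a t , us) , m)) X Y) (sym (perform-lift as ts))
        (run-D run halted e))

    module _ {i : Tape ⊥} {ds : Vec (Tape D.Work) D.workTapes} {m : TapesM} {X Y : Tally} where

      fetch-output : ∀ ls a rs {w} →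
        (∀ d → Explored borrow
          (i , ((d , ds) , (m , lastTape (bitPrefix (a ∷ rs) ʳ++ w) (blank ∷ [])))) X Y) →
        Explored fetch (i , ((tape ls a rs , ds) , (m , endTape w))) X Y
      fetch-output ls (bit b)  (r ∷ rs) e = follow refl refl (fetch-output _ r rs e)
      fetch-output ls (bit b)  []   {w} e = follow refl refl (fetch-end (b ∷ w) _ refl (e _))
        where
        fetch-end : ∀ w d → current d ≡ blank →
          Explored borrow (i , ((d , ds) , (m , lastTape w (blank ∷ [])))) X Y →
          Explored fetch (i , ((d , ds) , (m , endTape w))) X Y
        fetch-end w (tape _ blank _) refl e = follow refl refl
          (subst (λ t → Explored borrow (i , (_ , (m , t))) X Y) (sym (move-end w)) e)
      fetch-output ls blank    rs {w} e = follow refl refl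
          (subst (λ t → Explored borrow (i , (_ , (m , t))) X Y) (sym (move-end w)) (e _))
      fetch-output ls (work _) rs {w} e = follow refl refl
          (subst (λ t → Explored borrow (i , (_ , (m , t))) X Y) (sym (move-end w)) (e _))

    module _ {i : Tape ⊥} {d : TapesD} {m : Tape M.Work} {ms : Vec (Tape M.Work) M.workTapes} {X Y : Tally} where

      private
        ones : ℕ → List (Symbol ⊥)
        ones zero    = blank ∷ []
        ones (suc k) = bit 1b ∷ ones k

        ExploredC : State → Tape ⊥ → Set
        ExploredC q c = Explored q (i , (d , ((m , ms) , c))) X Y

      return : ∀ k b w → ExploredC guess (endTape (pad 1b k (b ∷ w))) →
               ExploredC guess (tape (List.map bit w) (bit b) (ones k))
      return zero    b w e = follow refl refl e
      return (suc k) b w e = follow refl refl (return k 1b (b ∷ w) e)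

      -- So far `k` low zeros have been turned into ones. If no digit 1 is found, the number was
      -- zero and the counter is now spoiled; hence `zero-case` must accept any `c`.
      borrow-loop : ∀ k w →
        (fromDigits (pad 0b k w) ≡ 0 → ∀ c →
          Explored rewindM (i , (d , ((move left m , ms) , c))) X Y) →
        (∀ v → fromDigits (pad 0b k w) ≡ suc (fromDigits v) → ExploredC guess (endTape v)) →
        ExploredC borrow (lastTape w (ones k))
      borrow-loop k []               zero-case suc-case =
        follow refl refl (zero-case (fromDigits-zeros k [] refl) _)
      borrow-loop k (zero ∷ w)       zero-case suc-case = follow refl refl
        (subst (ExploredC borrow) (sym (move-last 1b w (ones k)))
          (borrow-loop (suc k) w zero-case suc-case))
      borrow-loop k (suc zero ∷ w)   zero-case suc-case = follow refl refl
        (return k 0b w (suc-case _ (fromDigits-borrow k (1b ∷ w) (0b ∷ w) refl)))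

    -- The numeral is tracked only through its value, because decrementing leaves leading zeros.
    guess-word : ∀ {i d ms} n {u w F X} → fromDigits u ≡ n →
      (∀ (y : Vec Bit n) X c → Explored rewindM
        (i , (d , ((move left (endTape (Vec.toList y ʳ++ w)) , ms) , c))) X (F y X)) →
      Explored borrow (i , (d , ((endTape w , ms) , lastTape u (blank ∷ [])))) X (throughVec n F X)
    guess-word zero {u} eq e = borrow-loop 0 u (λ _ c → e [] _ c)
      (λ v eq′ → contradiction (trans (sym eq) eq′) ℕ.0≢1+n)
    guess-word {i} {d} {ms} (suc n) {u} {w} {F} {X} eq e = borrow-loop 0 u
      (λ eq′ → contradiction (trans (sym eq′) eq) ℕ.0≢1+n)
      (λ v eq′ → node refl
        (child v 0b (ℕ.suc-injective (trans (sym eq′) eq)) ∷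
         child v 1b (ℕ.suc-injective (trans (sym eq′) eq)) ∷ []))
      where
      child : ∀ {X} v b → fromDigits v ≡ n →
        Explored borrow (i , (d , ((endTape (b ∷ w) , ms) , move left (endTape v)))) X
          (throughVec n (F ∘ (b ∷_)) X)
      child v b eq = subst (λ c → Explored borrow (i , (d , ((endTape (b ∷ w) , ms) , c))) _ _)
        (sym (move-end v)) (guess-word n eq (λ y → e (b ∷ y)))

    module _ {i b : Tape ⊥} {d : TapesD} where

      halt-M : ∀ {c X} → M.Halted c →
        Explored (runM (state c)) (onM i d c b) X (addLeaf (does (M.accepting? c)) X)
      halt-M {c@(config q (t ∷ ts))} {X} halted =
        outcome t refl
        where
        noSteps : M.δ q (current t ∷ Vec.map current ts) ≡ []
        noSteps = map-≡-[] _ halted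
        Outcome : Bool → Set
        Outcome r = Explored (runM q) (onM i d c b) X (addLeaf r X)
        rejects : haltM (current t) ≡ to reject none none none none ∷ [] →
                  ¬ M.Accepting c → Outcome (does (M.accepting? c))
        rejects eq ¬acc = subst Outcome (sym (dec-false (M.accepting? c) ¬acc))
          (follow refl (trans (cong (λ l → stepsM l (current t)) noSteps) eq) (leaf refl))
        outcome : ∀ t′ → t ≡ t′ → Outcome (does (M.accepting? c))
        outcome (tape ls blank rs)          refl = rejects refl (λ ())
        outcome (tape ls (work _) rs)       refl = rejects refl (λ ())
        outcome (tape ls (bit zero) rs)     refl = rejects refl (λ ())
        outcome (tape ls (bit (suc zero)) (bit _ ∷ rs)) refl =
          subst Outcome (sym (dec-false (M.accepting? c) (λ ())))
            (follow refl (cong (λ l → stepsM l (bit 1b)) noSteps) (follow refl refl (leaf refl)))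
        outcome (tape ls (bit (suc zero)) []) refl =
          subst Outcome (sym (dec-true (M.accepting? c) refl))
            (follow refl (cong (λ l → stepsM l (bit 1b)) noSteps) (follow refl refl (leaf refl)))
        outcome (tape ls (bit (suc zero)) (blank ∷ rs)) refl =
          subst Outcome (sym (dec-true (M.accepting? c) refl))
            (follow refl (cong (λ l → stepsM l (bit 1b)) noSteps) (follow refl refl (leaf refl)))
        outcome (tape ls (bit (suc zero)) (work _ ∷ rs)) refl =
          subst Outcome (sym (dec-true (M.accepting? c) refl))
            (follow refl (cong (λ l → stepsM l (bit 1b)) noSteps) (follow refl refl (leaf refl)))

      mutual
        -- The bound `n` drives `branches` and `HaltsWithin` together: when it is used up the
        -- configuration has halted, so no cutoff is mistaken for a leaf.
        explore-M : ∀ n {c X} → M.HaltsWithin n c → Explored (runM (state c)) (onM i d c b) X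
          (addLeaves (labels M (List⁺.toList (M.branches n c))) X)
        explore-M zero    halted = halt-M halted
        explore-M (suc n) {config q (t ∷ ts)} halts =
          explore-node n _ refl halts

        explore-node : ∀ n {q t ts X} l → M.δ q (current t ∷ Vec.map current ts) ≡ l →
          All (M.HaltsWithin n) (List.map (M.apply (t ∷ ts)) l) →
          Explored (runM q) (onM i d (config q (t ∷ ts)) b) X
            (addLeaves (labels M (List⁺.toList
              (M.branchesVia n (config q (t ∷ ts)) (List.map (M.apply (t ∷ ts)) l)))) X)
        explore-node n []      eq halts = halt-M (cong (List.map _) eq)
        explore-node n {t = t} l@(_ ∷ _) eq halts = node (cong (λ l → stepsM l (current t)) eq)
          (explore-all n l halts)

        explore-all : ∀ n {t ts X} l → All (M.HaltsWithin n) (List.map (M.apply (t ∷ ts)) l) →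
          ExploredAll (i , (d , ((t , ts) , b))) (List.map liftM l) X (addLeaves (labels M (List.concat
            (List.map List⁺.toList (List.map (M.branches n) (List.map (M.apply (t ∷ ts)) l))))) X)
        explore-all n [] [] = []
        explore-all n {t} {ts} {X} ((q , a ∷ as) ∷ l) (h ∷ hs) =
          subst (ExploredAll _ _ X) (sym (trans
              (cong (λ bs → addLeaves bs X) (List.map-++ _ (List⁺.toList (M.branches n c)) rest))
              (addLeaves-++ (labels M (List⁺.toList (M.branches n c))) _ X)))
            (subst (λ us → Explored (runM q) (i , (d , ((act a t , us) , b))) X _)
              (sym (perform-lift as ts)) (explore-M n h)
            ∷ explore-all n l hs)
          where
          c = M.apply (t ∷ ts) (q , a ∷ as)
          rest = List.concat
            (List.map List⁺.toList (List.map (M.branches n) (List.map (M.apply (t ∷ ts)) l)))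

  run : ℕ → Word → List Bool
  run n z = labels M (List⁺.toList (M.branches n (M.initial z)))

  module _ (q₀ : State) where

    open Exploration q₀
    open Nondeterministic (machine q₀) using (Explored; node; []; _∷_)

    private
      noTapes : Vec (Tape M.Work) M.workTapes
      noTapes = Vec.replicate _ blankTape

    explore-launch : ∀ {i d b X} n z → M.HaltsWithin n (M.initial z) →
      Explored launch (onM i d (M.initial z) b) X (evaluate (addLeaves (run n z) X))
    explore-launch n z halts = node refl (explore-M n halts ∷ [])

    explore-copy : ∀ {X} n x → M.HaltsWithin n (M.initial x) →
      Explored copy (wordTape x , blanks s) X (evaluate (addLeaves (run n x) X))
    explore-copy {X} n x halts rewrite wordTape-suffix {⊥} x = copy-input x λ i →
      subst (λ z → Explored launch (i , (proj₁ (blanks s) , ((wordTape z , noTapes) , blankTape))) X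
                     (evaluate (addLeaves (run n x) X)))
        (sym (List.reverse-involutive x)) (explore-launch n x halts)

    explore-pair : ∀ {X} n (T : Word → ℕ) x → Outputs D x (binary n) →
      (∀ z → M.HaltsWithin (T z) (M.initial z)) →
      Explored pair (wordTape x , blanks s) X
        (throughVec n (λ y → let z = ⟨ x , Vec.toList y ⟩ in evaluate ∘ addLeaves (run (T z) z)) X)
    explore-pair {X} n T x (config _ (tape ls a rs ∷ ts) , runs , halted , out) halts
      rewrite wordTape-suffix {⊥} x = pair-input x λ i →
        subst (λ z → Explored (runD D.start) (i , ((wordTape z , Vec.replicate _ blankTape) , m₀)) X
                       (throughVec n F X))
          (sym (List.reverse-involutive x))
          (run-D {m = m₀} runs halted (fetch-output ls a rs λ d →
            subst (λ w → Explored borrow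
                (i , ((d , ts) , (proj₁ m₀ , lastTape w (blank ∷ [])))) X (throughVec n F X))
              (sym digits)
              (guess-word n {F = F} (proj₂ (toDigits 2 n)) λ y X b → rewind-end-M _
                (subst (λ z → Explored launch (i , ((d , ts) , ((wordTape z , noTapes) , b))) X (F y X))
                  (encoded (Vec.toList y)) (explore-launch (T _) _ (halts _))))))
      where
      F : Vec Bit n → Tally → Tally
      F y = evaluate ∘ addLeaves (run (T ⟨ x , Vec.toList y ⟩) ⟨ x , Vec.toList y ⟩)
      m₀ : TapesM × Tape ⊥
      m₀ = (endTape (0b ∷ (doubled x ʳ++ [])) , noTapes) , blankTape
      -- Read from its right end, `binary n` lists the digits least significant first, the order in
      -- which `borrow` meets them.
      digits : bitPrefix (a ∷ rs) ʳ++ [] ≡ proj₁ (toDigits 2 n)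
      digits = trans (cong (_ʳ++ []) out) (List.reverse-involutive _)
      encoded : ∀ y → ⟨ x , y ⟩ ≡ (y ʳ++ (0b ∷ (doubled x ʳ++ []))) ʳ++ []
      encoded y = begin
        ⟨ x , y ⟩
          ≡⟨ pair-doubled x y ⟩
        doubled x List.++ 0b ∷ y
          ≡⟨ List.ʳ++-ʳ++ (doubled x) ⟨
        (doubled x ʳ++ []) ʳ++ (0b ∷ y)
          ≡⟨ cong (λ y → (doubled x ʳ++ []) ʳ++ (0b ∷ y)) (List.++-identityʳ y) ⟨
        (doubled x ʳ++ []) ʳ++ (0b ∷ y List.++ [])
          ≡⟨ List.ʳ++-ʳ++ y ⟨
        (y ʳ++ (0b ∷ (doubled x ʳ++ []))) ʳ++ [] ∎
        where open ≡-Reasoning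

-- Tallies and acceptance probabilities

increment-⊖ : ∀ m n → increment (m ⊖ n) ≡ suc m ⊖ n
increment-⊖ m       zero          = refl
increment-⊖ zero    (suc zero)    = refl
increment-⊖ zero    (suc (suc n)) = refl
increment-⊖ (suc m) (suc n)       = begin
  increment (suc m ⊖ suc n) ≡⟨ cong increment (ℤ.[1+m]⊖[1+n]≡m⊖n m n) ⟩
  increment (m ⊖ n)         ≡⟨ increment-⊖ m n ⟩
  suc m ⊖ n                 ≡⟨ ℤ.[1+m]⊖[1+n]≡m⊖n (suc m) n ⟨
  suc (suc m) ⊖ suc n       ∎
  where open ≡-Reasoning

decrement-⊖ : ∀ m n → decrement (m ⊖ n) ≡ m ⊖ suc n
decrement-⊖ zero    zero    = refl
decrement-⊖ (suc m) zero    = refl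
decrement-⊖ zero    (suc n) = refl
decrement-⊖ (suc m) (suc n) = begin
  decrement (suc m ⊖ suc n) ≡⟨ cong decrement (ℤ.[1+m]⊖[1+n]≡m⊖n m n) ⟩
  decrement (m ⊖ n)         ≡⟨ decrement-⊖ m n ⟩
  m ⊖ suc n                 ≡⟨ ℤ.[1+m]⊖[1+n]≡m⊖n m (suc n) ⟨
  suc m ⊖ suc (suc n)       ∎
  where open ≡-Reasoning

nonNegative-⊖ : ∀ m n → nonNegative (m ⊖ n) ≡ does (n ℕ.≤? m)
nonNegative-⊖ m n with ℕ.≤-<-connex n m
... | inj₁ n≤m = trans (cong nonNegative (ℤ.⊖-≥ n≤m)) (sym (dec-true (n ℕ.≤? m) n≤m))
... | inj₂ m<n = trans
  (trans (cong nonNegative (ℤ.⊖-< m<n)) (negative (ℕ.m<n⇒0<n∸m m<n)))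
  (sym (dec-false (n ℕ.≤? m) (ℕ.<⇒≱ m<n)))
  where
  negative : ∀ {k} → 0 ℕ.< k → nonNegative (ℤ.- (+ k)) ≡ false
  negative {suc _} _ = refl

nonPositive-⊖ : ∀ m n → nonPositive (m ⊖ n) ≡ does (m ℕ.≤? n)
nonPositive-⊖ m n with ℕ.≤-<-connex m n
... | inj₁ m≤n = trans
  (trans (cong nonPositive (ℤ.⊖-≤ m≤n)) (negated (n ℕ.∸ m)))
  (sym (dec-true (m ℕ.≤? n) m≤n))
  where
  negated : ∀ k → nonPositive (ℤ.- (+ k)) ≡ true
  negated zero    = refl
  negated (suc _) = refl
... | inj₂ n<m = trans
  (trans (cong nonPositive (ℤ.⊖-≥ (ℕ.<⇒≤ n<m))) (positive (ℕ.m<n⇒0<n∸m n<m)))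
  (sym (dec-false (m ℕ.≤? n) (ℕ.<⇒≱ n<m)))
  where
  positive : ∀ {k} → 0 ℕ.< k → nonPositive (+ k) ≡ false
  positive {suc _} _ = refl

trues falses : List Bool → ℕ
trues []            = 0
trues (true  ∷ bs)  = suc (trues bs)
trues (false ∷ bs)  = trues bs
falses []           = 0
falses (true  ∷ bs) = falses bs
falses (false ∷ bs) = suc (falses bs)

double : ℕ → ℕ
double zero    = zero
double (suc n) = suc (suc (double n))

double≡+ : ∀ n → double n ≡ n ℕ.+ n
double≡+ zero    = refl
double≡+ (suc n) = cong suc (trans (cong suc (double≡+ n)) (sym (ℕ.+-suc n n)))

tally-cong : ∀ {m m′ n n′ k k′ l l′ f h} → m ≡ m′ → n ≡ n′ → k ≡ k′ → l ≡ l′ →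
             tally (m ⊖ n) (k ⊖ l) f h ≡ tally (m′ ⊖ n′) (k′ ⊖ l′) f h
tally-cong refl refl refl refl = refl

-- Arbitrary initial differences are allowed because `addLeaves` accumulates. Differences of
-- naturals avoid cases on the signs of the counters.
addLeaves-⊖ : ∀ bs {i j m n k l f h} → i ≡ m ⊖ n → j ≡ k ⊖ l →
  addLeaves bs (tally i j f h) ≡
  tally ((trues bs ℕ.+ m) ⊖ (double (falses bs) ℕ.+ n))
        ((double (trues bs) ℕ.+ k) ⊖ (falses bs ℕ.+ l)) f h
addLeaves-⊖ []           refl refl = refl
addLeaves-⊖ (true ∷ bs)  {m = m} {n} {k} {l} refl refl =
  trans
    (addLeaves-⊖ bs {m = suc m} {n} {suc (suc k)} {l} (increment-⊖ m n)
      (trans (cong increment (increment-⊖ k l)) (increment-⊖ (suc k) l)))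
    (tally-cong {n = double (falses bs) ℕ.+ n} {l = falses bs ℕ.+ l}
      (ℕ.+-suc (trues bs) m) refl
      (trans (ℕ.+-suc (double (trues bs)) (suc k)) (cong suc (ℕ.+-suc (double (trues bs)) k))) refl)
addLeaves-⊖ (false ∷ bs) {m = m} {n} {k} {l} refl refl =
  trans
    (addLeaves-⊖ bs {m = m} {suc (suc n)} {k} {suc l}
      (trans (cong decrement (decrement-⊖ m n)) (decrement-⊖ m (suc n))) (decrement-⊖ k l))
    (tally-cong {m = trues bs ℕ.+ m} {k = double (trues bs) ℕ.+ k} refl
      (trans (ℕ.+-suc (double (falses bs)) (suc n)) (cong suc (ℕ.+-suc (double (falses bs)) n)))
      refl (ℕ.+-suc (falses bs) l))

-- Cross-multiplication, carried out on unnormalised rationals because `_/_` reduces fractions. The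
-- arguments `b` and `d` are one less than the denominators.
/-≤ : ∀ a b c d → (+ a / suc b ≤ + c / suc d) ⇔ (a ℕ.* suc d ℕ.≤ c ℕ.* suc b)
/-≤ a b c d = mk⇔ to from
  where
  p = mkℚᵘ (+ a) b
  q = mkℚᵘ (+ c) d
  to : + a / suc b ≤ + c / suc d → a ℕ.* suc d ℕ.≤ c ℕ.* suc b
  to r with ℚᵘ.≤-respˡ-≃ (ℚ.toℚᵘ-fromℚᵘ p) (ℚᵘ.≤-respʳ-≃ (ℚ.toℚᵘ-fromℚᵘ q) (ℚ.toℚᵘ-mono-≤ r))
  ... | *≤* s = ℤ.drop‿+≤+ (subst₂ ℤ._≤_ (sym (ℤ.pos-* a (suc d))) (sym (ℤ.pos-* c (suc b))) s)
  from : a ℕ.* suc d ℕ.≤ c ℕ.* suc b → + a / suc b ≤ + c / suc d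
  from s = ℚ.toℚᵘ-cancel-≤
    (ℚᵘ.≤-respˡ-≃ (ℚᵘ.≃-sym (ℚ.toℚᵘ-fromℚᵘ p)) (ℚᵘ.≤-respʳ-≃ (ℚᵘ.≃-sym (ℚ.toℚᵘ-fromℚᵘ q))
      (*≤* (subst₂ ℤ._≤_ (ℤ.pos-* a (suc d)) (ℤ.pos-* c (suc b)) (ℤ.+≤+ s)))))

⅔ ⅓ : ℚ
⅔ = + 2 / 3
⅓ = + 1 / 3

+-≤-⇔ : ∀ k {m n m′ n′} → m′ ≡ k ℕ.+ m → n′ ≡ k ℕ.+ n → (m′ ℕ.≤ n′) ⇔ (m ℕ.≤ n)
+-≤-⇔ k refl refl = mk⇔ (ℕ.+-cancelˡ-≤ k _ _) (ℕ.+-monoʳ-≤ k)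

module _ {a r k : ℕ} (total : suc k ≡ a ℕ.+ r) where

  private
    *3 : ∀ a → a ℕ.* 3 ≡ (a ℕ.+ a) ℕ.+ a
    *3 = solve-∀

    2* : ∀ a r → 2 ℕ.* (a ℕ.+ r) ≡ (a ℕ.+ a) ℕ.+ (r ℕ.+ r)
    2* = solve-∀

  -- Cross-multiplying gives `2(a + r) ≤ 3a`; cancelling `2a` leaves the sign of the excess.
  ⅔≤-⇔ : (⅔ ≤ + a / suc k) ⇔ (double r ℕ.≤ a)
  ⅔≤-⇔ = +-≤-⇔ (a ℕ.+ a)
      (trans (cong (2 ℕ.*_) total) (trans (2* a r) (cong ((a ℕ.+ a) ℕ.+_) (sym (double≡+ r)))))
      (*3 a)
    ⇔-∘ /-≤ 2 2 a k

  -- Cross-multiplying gives `3a ≤ a + r`; cancelling `a` leaves the sign of the deficit.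
  ≤⅓-⇔ : (+ a / suc k ≤ ⅓) ⇔ (double a ℕ.≤ r)
  ≤⅓-⇔ = +-≤-⇔ a
      (trans (*3 a) (trans (ℕ.+-assoc a a a) (cong (a ℕ.+_) (sym (double≡+ a)))))
      (trans (ℕ.+-identityʳ (suc k)) total)
    ⇔-∘ /-≤ a k 1 2

length-accepting : ∀ M cs → List.length (filter (TM.accepting? M) cs) ≡ trues (labels M cs)
length-accepting M []       = refl
length-accepting M (c ∷ cs) with does (TM.accepting? M c)
... | true  = cong suc (length-accepting M cs)
... | false = length-accepting M cs

length-labels : ∀ M cs → List.length cs ≡ trues (labels M cs) ℕ.+ falses (labels M cs)
length-labels M []       = refl
length-labels M (c ∷ cs) with does (TM.accepting? M c)
... | true  = cong suc (length-labels M cs)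
... | false = trans (cong suc (length-labels M cs)) (sym (ℕ.+-suc _ _))

evaluate-addLeaves : ∀ bs {n} → suc n ≡ trues bs ℕ.+ falses bs → ∀ f h →
  evaluate (addLeaves bs (tally (+ 0) (+ 0) f h)) ≡
  tally (+ 0) (+ 0) (f ∨ does (⅔ ℚ.≤? + trues bs / suc n)) (h ∧ does (+ trues bs / suc n ℚ.≤? ⅓))
evaluate-addLeaves bs {n} total f h = trans
  (cong evaluate (trans
    (addLeaves-⊖ bs {m = 0} {0} {0} {0} refl refl)
    (tally-cong (ℕ.+-identityʳ a) (ℕ.+-identityʳ (double r))
                (ℕ.+-identityʳ (double a)) (ℕ.+-identityʳ r))))
  (cong₂ (λ b c → tally (+ 0) (+ 0) (f ∨ b) (h ∧ c))
    (trans (nonNegative-⊖ a (double r))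
      (sym (does-⇔ (⅔≤-⇔ total) (⅔ ℚ.≤? + a / suc n) (double r ℕ.≤? a))))
    (trans (nonPositive-⊖ (double a) r)
      (sym (does-⇔ (≤⅓-⇔ total) (+ a / suc n ℚ.≤? ⅓) (double a ℕ.≤? r)))))
  where
  a r : ℕ
  a = trues bs
  r = falses bs

module _ (P : PolytimePTM) where

  open PolytimePTM P

  steps : Word → ℕ
  steps x = eval (proj₁ runtime) (List.length x)

  leaves : Word → List Bool
  leaves x = labels machine (List⁺.toList (allBranches x))

  evaluate-leaves : ∀ x f h → evaluate (addLeaves (leaves x) (tally (+ 0) (+ 0) f h)) ≡
    tally (+ 0) (+ 0) (f ∨ does (⅔ ℚ.≤? Pacc x)) (h ∧ does (Pacc x ℚ.≤? ⅓))
  evaluate-leaves x f h = trans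
    (evaluate-addLeaves (leaves x) (length-labels machine (List⁺.toList (allBranches x))) f h)
    (cong (λ a → tally (+ 0) (+ 0)
        (f ∨ does (⅔ ℚ.≤? + a / List⁺.length (allBranches x)))
        (h ∧ does (+ a / List⁺.length (allBranches x) ℚ.≤? ⅓)))
      (sym (length-accepting machine (List⁺.toList (allBranches x)))))

-- Thresholds for the maximum over all proofs

≤⊔-⇔ : ∀ p q r → (p ≤ q ⊔ r) ⇔ (p ≤ q ⊎ p ≤ r)
≤⊔-⇔ p q r = mk⇔ to
  [ (λ p≤q → ℚ.≤-trans p≤q (ℚ.p≤p⊔q q r)) , (λ p≤r → ℚ.≤-trans p≤r (ℚ.p≤q⊔p q r)) ]′
  where
  to : p ≤ q ⊔ r → p ≤ q ⊎ p ≤ r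
  to p≤ with ℚ.⊔-sel q r
  ... | inj₁ ≡q = inj₁ (subst (p ≤_) ≡q p≤)
  ... | inj₂ ≡r = inj₂ (subst (p ≤_) ≡r p≤)

⊔≤-⇔ : ∀ p q r → (q ⊔ r ≤ p) ⇔ (q ≤ p × r ≤ p)
⊔≤-⇔ p q r = mk⇔
  (λ ≤p → ℚ.≤-trans (ℚ.p≤p⊔q q r) ≤p , ℚ.≤-trans (ℚ.p≤q⊔p q r) ≤p)
  (λ (q≤p , r≤p) → ℚ.⊔-lub q≤p r≤p)

-- Both sides recurse on the first bit of the proof. The second half starts from the flags left by
-- the first and from counters back at zero, so associativity of `∨` and `∧` joins the halves.
throughVec-maxOver : ∀ n (F : Vec Bit n → Tally → Tally) (v : Vec Bit n → ℚ) →
  (∀ y f h → F y (tally (+ 0) (+ 0) f h) ≡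
             tally (+ 0) (+ 0) (f ∨ does (⅔ ℚ.≤? v y)) (h ∧ does (v y ℚ.≤? ⅓))) →
  ∀ f h → throughVec n F (tally (+ 0) (+ 0) f h) ≡
          tally (+ 0) (+ 0) (f ∨ does (⅔ ℚ.≤? maxOver n v)) (h ∧ does (maxOver n v ℚ.≤? ⅓))
throughVec-maxOver zero    F v eq f h = eq [] f h
throughVec-maxOver (suc n) F v eq f h
  rewrite throughVec-maxOver n (F ∘ (0b ∷_)) (v ∘ (0b ∷_)) (eq ∘ (0b ∷_)) f h
        | throughVec-maxOver n (F ∘ (1b ∷_)) (v ∘ (1b ∷_)) (eq ∘ (1b ∷_))
            (f ∨ does (⅔ ℚ.≤? maxOver n (v ∘ (0b ∷_)))) (h ∧ does (maxOver n (v ∘ (0b ∷_)) ℚ.≤? ⅓)) =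
  cong₂ (tally (+ 0) (+ 0))
    (trans (Bool.∨-assoc f _ _) (cong (f ∨_)
      (sym (does-⇔ (≤⊔-⇔ ⅔ p q) (⅔ ℚ.≤? p ⊔ q) ((⅔ ℚ.≤? p) ⊎-dec (⅔ ℚ.≤? q))))))
    (trans (Bool.∧-assoc h _ _) (cong (h ∧_)
      (sym (does-⇔ (⊔≤-⇔ ⅓ p q) (p ⊔ q ℚ.≤? ⅓) ((p ℚ.≤? ⅓) ×-dec (q ℚ.≤? ⅓))))))
  where
  p q : ℚ
  p = maxOver n (v ∘ (0b ∷_))
  q = maxOver n (v ∘ (1b ∷_))


-- Total decidability of the extremal problems

extremal-totallyDecidable : ∀ v (D : DTM) →
  (∀ x → Outputs D x (verdict (does (⅔ ℚ.≤? v x)) (does (v x ℚ.≤? ⅓)))) →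
  TotallyDecidable (extremal v)
extremal-totallyDecidable v D out = D , onYes , onNo , otherwise
  where
  open PromiseProblem (extremal v)
  onYes : ∀ x → yes x → Outputs D x (1b ∷ [])
  onYes x v≥⅔ = subst (λ b → Outputs D x (verdict b (does (v x ℚ.≤? ⅓)))) (dec-true (⅔ ℚ.≤? v x) v≥⅔) (out x)
  onNo : ∀ x → no x → Outputs D x (0b ∷ [])
  onNo x v≤⅓ = subst₂ (λ b c → Outputs D x (verdict b c))
    (dec-false (⅔ ℚ.≤? v x) (λ v≥⅔ → disjoint (v≥⅔ , v≤⅓))) (dec-true (v x ℚ.≤? ⅓) v≤⅓) (out x)
  otherwise : ∀ x → ¬ yes x → ¬ no x → Outputs D x (1b ∷ 0b ∷ [])
  otherwise x v≱⅔ v≰⅓ = subst₂ (λ b c → Outputs D x (verdict b c))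
    (dec-false (⅔ ℚ.≤? v x) v≱⅔) (dec-false (v x ℚ.≤? ⅓) v≰⅓) (out x)

-- A BPP-machine takes no proof, so a trivial machine stands in for the computer of the proof
-- length.
idle : DTM
idle = record
  { machine = record
    { State       = ⊤
    ; Work        = ⊥
    ; finiteState = finite-⊤
    ; finiteWork  = finite-⊥
    ; workTapes   = 0
    ; start       = tt
    ; δ           = λ _ _ → []
    ; δ-unique    = λ _ _ → []
    }
  ; deterministic = λ _ _ → z≤n
  }

bpp-totallyDecidable : (M : PromiseBPPMachine) → TotallyDecidable (P-BPP M)
bpp-totallyDecidable M = extremal-totallyDecidable v decider λ x →
  subst (λ X → Outputs decider x (verdict (some X) (all X))) (evaluate-leaves ptm x false true)
    (search-outputs (explore-copy copying (steps ptm x) x (proj₂ runtime x)))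
  where
  open PromiseBPPMachine M
  open PolytimePTM ptm using (machine; runtime)
  open Guessing idle machine using (explore-copy; copying)
  open Search (Guessing.machine idle machine copying) using (decider; search-outputs)

ma-totallyDecidable : (M : PromiseMAMachine) → TotallyDecidable (P-MA M)
ma-totallyDecidable M = extremal-totallyDecidable v decider λ x →
  subst (λ X → Outputs decider x (verdict (some X) (all X)))
    (throughVec-maxOver (m (List.length x)) _ _
      (λ y → evaluate-leaves ptm ⟨ x , Vec.toList y ⟩) false true)
    (search-outputs (explore-pair pairing (m (List.length x)) (steps ptm) x (computes x) (proj₂ runtime)))
  where
  open PromiseMAMachine M
  open Poly m∈poly using (computer; computes)
  open PolytimePTM ptm using (machine; runtime)
  open Guessing computer machine using (explore-pair; pairing)
  open Search (Guessing.machine computer machine pairing) using (decider; search-outputs)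

lemma3 : ((M : PromiseBPPMachine) → TotallyDecidable (P-BPP M)) × ((M : PromiseMAMachine) → TotallyDecidable (P-MA M))
lemma3 = bpp-totallyDecidable , ma-totallyDecidable
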